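{- Let $n\ge 2$ be an integer. For every $D\in\mathcal{D}_n$, $${\rm per}(A_D)\le \omega(4n,n^2).$$ For $n$ even this inequality is sharp, i.e. there exists $D\in\mathcal{D}_n$ with ${\rm per}(A_D)=\omega(4n,n^2)$.
   Context: $K_{n,n}$ is the complete bipartite graph on $2n$ vertices. $\mathcal{D}_n$ is the set of all digraphs obtained from $K_{n,n}$ by assigning a direction to each edge. For $D\in\mathcal{D}_n$, $A_D$ is its $(0,1)$ adjacency matrix of order $2n$ (entry $1$ in position $(i,j)$ exactly when $(v_i,v_j)$ is a directed edge), and ${\rm per}$ denotes the permanent; ${\rm per}(A_D)$ is the number of directed $2$-factors of $D$ (disjoint unions of directed cycles covering all vertices). For positive integers $N\le M$, $$\omega(2N,M):=\left(\lfloor \tfrac{M}{N}\rfloor !\right)^{\frac{N-\alpha}{\lfloor M/N\rfloor}}\left(\lceil \tfrac{M}{N}\rceil !\right)^{\frac{\alpha}{\lceil M/N\rceil}},\qquad \alpha:=M-N\lfloor \tfrac{M}{N}\rfloor .$$ Thus $\omega(4n,n^2)$ is this quantity with $N=2n$ and $M=n^2$. -}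

module Defs where

open import Algebra.Definitions.RawSemiring using ()
open import Data.Bool.Base using (Bool; true; false; not; _xor_; if_then_else_; T)
open import Data.Bool.Properties using (xor-comm; xor-same)
open import Data.Empty using (⊥)
open import Data.Fin.Base using (Fin; zero; suc; punchIn; splitAt)
open import Data.Fin.Permutation as Perm using (Permutation′; _⟨$⟩ʳ_)
open import Data.Fin.Properties using (punchIn-injective)
open import Data.Integer.Base as ℤ using (+_)
import Data.Integer.Properties as ℤ
open import Data.List.Base using (List; []; _∷_; map; concatMap; allFin)
open import Data.List.Membership.Propositional.Properties using (∈-allFin)
open import Data.List.Relation.Unary.All as All using ([]; _∷_)
import Data.List.Relation.Unary.All.Properties as All
open import Data.List.Relation.Unary.AllPairs as AllPairs using (AllPairs; []; _∷_)
import Data.List.Relation.Unary.AllPairs.Properties as AllPairs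
open import Data.List.Relation.Unary.Any as Any using (Any; here)
import Data.List.Relation.Unary.Any.Properties as Any
open import Data.List.Relation.Unary.Unique.Propositional.Properties using (allFin⁺)
open import Data.Nat.Base as ℕ using (ℕ; zero; suc; NonZero; _∸_; _!)
import Data.Nat.DivMod as ℕ
open import Data.Nat.ListAction using (sum; product)
import Data.Nat.Properties as ℕ
open import Data.Product.Base using (Σ; ∃; _×_; _,_; proj₁; proj₂)
open import Data.Rational.Base hiding (NonZero; floor; ceiling; truncate)
open import Data.Rational.Properties
open import Data.Rational.Solver using (module +-*-Solver)
import Data.Rational.Unnormalised.Base as ℚᵘ
import Data.Rational.Unnormalised.Properties as ℚᵘ
open import Data.Sum.Base using (_⊎_; inj₁; inj₂; [_,_]′)
open import Function.Base using (const)
open import Relation.Binary.Definitions using (tri<; tri≈; tri>)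
open import Relation.Binary.PropositionalEquality hiding ([_])
open import Relation.Nullary using (¬_; yes; no; contradiction)

open Algebra.Definitions.RawSemiring +-*-rawSemiring using (_^_)
  renaming (_×_ to _·_)

ι : ℕ → ℚ
ι n = + n / 1

toℚᵘ-ι : ∀ n → toℚᵘ (ι n) ℚᵘ.≃ ℚᵘ.mkℚᵘ (+ n) 0
toℚᵘ-ι n = toℚᵘ-fromℚᵘ (ℚᵘ.mkℚᵘ (+ n) 0)

0≤ι : ∀ n → 0ℚ ≤ ι n
0≤ι n = toℚᵘ-cancel-≤ (ℚᵘ.≤-respʳ-≃ (ℚᵘ.≃-sym (toℚᵘ-ι n))
  (ℚᵘ.*≤* (subst₂ ℤ._≤_ refl (sym (ℤ.*-identityʳ (+ n))) (ℤ.+≤+ ℕ.z≤n))))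

ι-suc : ∀ n → ι (suc n) ≡ 1ℚ + ι n
ι-suc n = toℚᵘ-injective (begin
  toℚᵘ (ι (suc n))                       ≈⟨ toℚᵘ-ι (suc n) ⟩
  ℚᵘ.mkℚᵘ (+ suc n) 0                    ≡⟨ cong (λ k → ℚᵘ.mkℚᵘ (+ suc k) 0) (sym (ℕ.*-identityʳ n)) ⟩
  ℚᵘ.mkℚᵘ (+ suc (n ℕ.* 1)) 0            ≡⟨ cong (λ z → ℚᵘ.mkℚᵘ (+ 1 ℤ.+ z) 0) (ℤ.pos-* n 1) ⟩
  toℚᵘ 1ℚ ℚᵘ.+ ℚᵘ.mkℚᵘ (+ n) 0           ≈⟨ ℚᵘ.+-congʳ (toℚᵘ 1ℚ) (toℚᵘ-ι n) ⟨
  toℚᵘ 1ℚ ℚᵘ.+ toℚᵘ (ι n)                ≈⟨ toℚᵘ-homo-+ 1ℚ (ι n) ⟨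
  toℚᵘ (1ℚ + ι n)                        ∎)
  where open ℚᵘ.≃-Reasoning

0<1 : 0ℚ < 1ℚ
0<1 = positive⁻¹ 1ℚ

p<p+h : ∀ p {h} → 0ℚ < h → p < p + h
p<p+h p {h} 0<h = subst (_< p + h) (+-identityʳ p) (+-monoʳ-< p 0<h)

p-h<p : ∀ p {h} → 0ℚ < h → p - h < p
p-h<p p {h} 0<h = subst (p - h <_) (+-identityʳ p) (+-monoʳ-< p (neg-antimono-< 0<h))

p<q⇒0<q-p : ∀ {p q} → p < q → 0ℚ < q - p
p<q⇒0<q-p {p} {q} p<q = subst (_< q - p) (+-inverseʳ p) (+-monoˡ-< (- p) p<q)

p+[q-p]≡q : ∀ p q → p + (q - p) ≡ q
p+[q-p]≡q = solve 2 (λ p q → p :+ (q :- p) := q) refl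
  where open +-*-Solver

*-monoˡ : ∀ {r p q} → 0ℚ ≤ r → p ≤ q → r * p ≤ r * q
*-monoˡ {r} 0≤r = *-monoˡ-≤-nonNeg r {{nonNegative 0≤r}}

*-monoʳ : ∀ {r p q} → 0ℚ ≤ r → p ≤ q → p * r ≤ q * r
*-monoʳ {r} 0≤r = *-monoʳ-≤-nonNeg r {{nonNegative 0≤r}}

0≤* : ∀ {p q} → 0ℚ ≤ p → 0ℚ ≤ q → 0ℚ ≤ p * q
0≤* {p} {q} 0≤p 0≤q = subst (_≤ p * q) (*-zeroʳ p) (*-monoˡ 0≤p 0≤q)

0≤+ : ∀ {p q} → 0ℚ ≤ p → 0ℚ ≤ q → 0ℚ ≤ p + q
0≤+ 0≤p 0≤q = +-mono-≤ 0≤p 0≤q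

<-⊓ : ∀ {p q r} → p < q → p < r → p < q ⊓ r
<-⊓ {p} {q} {r} p<q p<r with ⊓-sel q r
... | inj₁ e = subst (p <_) (sym e) p<q
... | inj₂ e = subst (p <_) (sym e) p<r

small : ∀ {K ε} → 0ℚ ≤ K → 0ℚ < ε → ∃ λ h → 0ℚ < h × h ≤ 1ℚ × h * K < ε
small {K} {ε} 0≤K 0<ε = h , 0<h , h≤1 , hK<ε
  where
  D = K + 1ℚ + ε
  0<K+1 : 0ℚ < K + 1ℚ
  0<K+1 = +-mono-≤-< 0≤K 0<1
  0<D : 0ℚ < D
  0<D = +-mono-< 0<K+1 0<ε
  instance
    D-pos : Positive D
    D-pos = positive 0<D
    D-nz = pos⇒nonZero D
  h = ε * (1/ D)
  hD≡ε : h * D ≡ ε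
  hD≡ε = trans (*-assoc ε (1/ D) D) (trans (cong (ε *_) (*-inverseˡ D)) (*-identityʳ ε))
  0<h : 0ℚ < h
  0<h = positive⁻¹ h {{pos*pos⇒pos ε {{positive 0<ε}} (1/ D) {{1/pos⇒pos D}}}}
  h≤1 : h ≤ 1ℚ
  h≤1 = *-cancelʳ-≤-pos D (subst₂ _≤_ (sym hD≡ε) (sym (*-identityˡ D))
          (<⇒≤ (subst (_< D) (+-identityˡ ε) (+-monoˡ-< ε 0<K+1))))
  hK<ε : h * K < ε
  hK<ε = subst (h * K <_) hD≡ε (*-monoʳ-<-pos h {{positive 0<h}}
           (<-trans (p<p+h K 0<1) (p<p+h (K + 1ℚ) 0<ε)))

archimedean : ∀ {h} → 0ℚ < h → ∀ p → ∃ λ n → p ≤ n · h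
archimedean {h} 0<h p = n , subst₂ _≤_ qh≡p (sym (n·h≡ιn*h n)) (*-monoʳ (<⇒≤ 0<h) (q≤ι q))
  where
  instance
    h-nz = pos⇒nonZero h {{positive 0<h}}
  q = p * (1/ h)
  n = ℤ.∣ ↥ q ∣
  qh≡p : q * h ≡ p
  qh≡p = trans (*-assoc p (1/ h) h) (trans (cong (p *_) (*-inverseˡ h)) (*-identityʳ p))
  q≤ι : ∀ q → q ≤ ι ℤ.∣ ↥ q ∣
  q≤ι q@(mkℚ (+ k) d _) = toℚᵘ-cancel-≤ (ℚᵘ.≤-respʳ-≃ (ℚᵘ.≃-sym (toℚᵘ-ι k))
    (ℚᵘ.*≤* (ℤ.*-monoˡ-≤-nonNeg (+ k) (ℤ.+≤+ (ℕ.s≤s ℕ.z≤n)))))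
  q≤ι q@(mkℚ ℤ.-[1+ k ] d _) = ≤-trans (<⇒≤ (negative⁻¹ q)) (0≤ι (suc k))
  n·h≡ιn*h : ∀ n → n · h ≡ ι n * h
  n·h≡ιn*h zero    = sym (*-zeroˡ h)
  n·h≡ιn*h (suc n) = trans (cong₂ _+_ (sym (*-identityˡ h)) (n·h≡ιn*h n))
    (trans (sym (*-distribʳ-+ h 1ℚ (ι n))) (cong (_* h) (sym (ι-suc n))))

^-nonNeg : ∀ {p} n → 0ℚ ≤ p → 0ℚ ≤ p ^ n
^-nonNeg zero    0≤p = <⇒≤ 0<1
^-nonNeg (suc n) 0≤p = 0≤* 0≤p (^-nonNeg n 0≤p)

^-mono-≤ : ∀ {p q} n → 0ℚ ≤ p → p ≤ q → p ^ n ≤ q ^ n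
^-mono-≤ zero    0≤p p≤q = ≤-refl
^-mono-≤ (suc n) 0≤p p≤q =
  ≤-trans (*-monoˡ 0≤p (^-mono-≤ n 0≤p p≤q)) (*-monoʳ (^-nonNeg n (≤-trans 0≤p p≤q)) p≤q)

^-mono-< : ∀ {p q} n .{{_ : NonZero n}} → 0ℚ ≤ p → p < q → p ^ n < q ^ n
^-mono-< {p} {q} (suc n) 0≤p p<q = ≤-<-trans
  (*-monoˡ 0≤p (^-mono-≤ n 0≤p (<⇒≤ p<q)))
  (*-monoˡ-<-pos (q ^ n) {{positive (0<^ n)}} p<q)
  where
  0<q : 0ℚ < q
  0<q = ≤-<-trans 0≤p p<q
  0<^ : ∀ n → 0ℚ < q ^ n
  0<^ zero    = 0<1
  0<^ (suc n) = positive⁻¹ _ {{pos*pos⇒pos q {{positive 0<q}} (q ^ n) {{positive (0<^ n)}}}}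

p≤p^n : ∀ {p} n .{{_ : NonZero n}} → 1ℚ ≤ p → p ≤ p ^ n
p≤p^n {p} (suc n) 1≤p = subst (_≤ p * p ^ n) (*-identityʳ p) (*-monoˡ 0≤p 1≤p^n)
  where
  0≤p = ≤-trans (<⇒≤ 0<1) 1≤p
  1^n : ∀ n → 1ℚ ^ n ≡ 1ℚ
  1^n zero    = refl
  1^n (suc n) = trans (*-identityˡ (1ℚ ^ n)) (1^n n)
  1≤p^n : 1ℚ ≤ p ^ n
  1≤p^n = subst (_≤ p ^ n) (1^n n) (^-mono-≤ n (<⇒≤ 0<1) 1≤p)

^-lipschitz : ∀ n {B} → 0ℚ ≤ B → ∃ λ K → 0ℚ ≤ K ×
              (∀ {u h} → 0ℚ ≤ u → 0ℚ ≤ h → u + h ≤ B → (u + h) ^ n ≤ u ^ n + h * K)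
^-lipschitz zero 0≤B = 0ℚ , ≤-refl , λ {u} {h} _ _ _ →
  ≤-reflexive (sym (trans (cong (λ z → 1ℚ + z) (*-zeroʳ h)) (+-identityʳ 1ℚ)))
^-lipschitz (suc n) {B} 0≤B with K , 0≤K , bound ← ^-lipschitz n {B} 0≤B =
  B * K + B ^ n , 0≤+ (0≤* 0≤B 0≤K) (^-nonNeg n 0≤B) , bound′
  where
  open ≤-Reasoning
  bound′ : ∀ {u h} → 0ℚ ≤ u → 0ℚ ≤ h → u + h ≤ B →
           (u + h) ^ suc n ≤ u ^ suc n + h * (B * K + B ^ n)
  bound′ {u} {h} 0≤u 0≤h v≤B = begin
    (u + h) * (u + h) ^ n                         ≤⟨ *-monoˡ (0≤+ 0≤u 0≤h) (bound 0≤u 0≤h v≤B) ⟩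
    (u + h) * (u ^ n + h * K)                     ≡⟨ expand u h (u ^ n) K ⟩
    u * u ^ n + h * ((u + h) * K + u ^ n)         ≤⟨ +-monoʳ-≤ (u * u ^ n) (*-monoˡ 0≤h
                                                       (+-mono-≤ (*-monoʳ 0≤K v≤B) (^-mono-≤ n 0≤u u≤B))) ⟩
    u * u ^ n + h * (B * K + B ^ n)               ∎
    where
    u≤B : u ≤ B
    u≤B = ≤-trans (subst (_≤ u + h) (+-identityʳ u) (+-monoʳ-≤ u 0≤h)) v≤B
    open +-*-Solver
    expand : ∀ u h w K → (u + h) * (w + h * K) ≡ u * w + h * ((u + h) * K + w)
    expand = solve 4 (λ u h w K → (u :+ h) :* (w :+ h :* K)
                               := u :* w :+ h :* ((u :+ h) :* K :+ w)) refl

^-openˡ : ∀ n {p r} → 0ℚ ≤ p → p ^ n < r → ∃ λ q → p < q × q ^ n < r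
^-openˡ n {p} {r} 0≤p p^n<r =
  let K , 0≤K , bound    = ^-lipschitz n {p + 1ℚ} (0≤+ 0≤p (<⇒≤ 0<1))
      h , 0<h , h≤1 , hK<ε = small 0≤K (p<q⇒0<q-p p^n<r)
  in p + h , p<p+h p 0<h , ≤-<-trans
       (bound 0≤p (<⇒≤ 0<h) (+-monoʳ-≤ p h≤1))
       (subst (p ^ n + h * K <_) (p+[q-p]≡q (p ^ n) r) (+-monoʳ-< (p ^ n) hK<ε))

^-openʳ : ∀ n {q r} → 0ℚ < q → r < q ^ n → ∃ λ p → p < q × 0ℚ < p × r < p ^ n
^-openʳ n {q} {r} 0<q r<q^n =
  let K , 0≤K , bound      = ^-lipschitz n {q} (<⇒≤ 0<q)
      h , 0<h , _ , h[K+1]<ε = small (0≤+ 0≤K (<⇒≤ 0<1)) (<-⊓ (p<q⇒0<q-p r<q^n) 0<q)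
  in step 0≤K bound 0<h h[K+1]<ε
  where
  open +-*-Solver
  step : ∀ {K h} → 0ℚ ≤ K →
         (∀ {u h} → 0ℚ ≤ u → 0ℚ ≤ h → u + h ≤ q → (u + h) ^ n ≤ u ^ n + h * K) →
         0ℚ < h → h * (K + 1ℚ) < (q ^ n - r) ⊓ q → ∃ λ p → p < q × 0ℚ < p × r < p ^ n
  step {K} {h} 0≤K bound 0<h h[K+1]<ε = q - h , p-h<p q 0<h , 0<u ,
    +-cancelʳ-< (h * K) (<-≤-trans r+hK<q^n q^n≤)
    where
    0≤h = <⇒≤ 0<h
    hK≤ : h * K ≤ h * (K + 1ℚ)
    hK≤ = *-monoˡ 0≤h (<⇒≤ (p<p+h K 0<1))
    h≤ : h ≤ h * (K + 1ℚ)
    h≤ = subst (_≤ h * (K + 1ℚ)) (*-identityʳ h)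
           (*-monoˡ 0≤h (subst (_≤ K + 1ℚ) (+-identityˡ 1ℚ) (+-monoˡ-≤ 1ℚ 0≤K)))
    0<u : 0ℚ < q - h
    0<u = p<q⇒0<q-p (<-≤-trans (≤-<-trans h≤ h[K+1]<ε) (p⊓q≤q (q ^ n - r) q))
    r+hK<q^n : r + h * K < q ^ n
    r+hK<q^n = subst (r + h * K <_) (p+[q-p]≡q r (q ^ n)) (+-monoʳ-< r
      (<-≤-trans (≤-<-trans hK≤ h[K+1]<ε) (p⊓q≤p (q ^ n - r) q)))
    u+h≡q : q - h + h ≡ q
    u+h≡q = solve 2 (λ q h → q :- h :+ h := q) refl q h
    q^n≤ : q ^ n ≤ (q - h) ^ n + h * K
    q^n≤ = subst (λ z → z ^ n ≤ (q - h) ^ n + h * K) u+h≡q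
             (bound (<⇒≤ 0<u) 0≤h (≤-reflexive u+h≡q))
    +-cancelʳ-< : ∀ s {p q} → p + s < q + s → p < q
    +-cancelʳ-< s {p} {q} lt = subst₂ _<_ (drop p s) (drop q s) (+-monoˡ-< (- s) lt)
      where
      drop : ∀ p s → p + s - s ≡ p
      drop = solve 2 (λ p s → p :+ s :- s := p) refl

-- Two-sided Dedekind cuts of ℚ: L is the set of rationals below the
-- number and U the set of rationals above it.
record ℝ : Set₁ where
  field
    L U         : ℚ → Set
    L-inhabited : ∃ L
    U-inhabited : ∃ U
    L-lower     : ∀ {p q} → p < q → L q → L p
    U-upper     : ∀ {p q} → p < q → U p → U q
    L-open      : ∀ {p} → L p → ∃ λ q → p < q × L q
    U-open      : ∀ {q} → U q → ∃ λ p → p < q × U p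
    disjoint    : ∀ {p} → L p → U p → ⊥
    located     : ∀ {p q} → p < q → L p ⊎ U q

open ℝ

infix 4 _≤ℝ_ _≈ℝ_

_≤ℝ_ : ℝ → ℝ → Set
x ≤ℝ y = ∀ q → L x q → L y q

_≈ℝ_ : ℝ → ℝ → Set
x ≈ℝ y = x ≤ℝ y × y ≤ℝ x

fromℕ : ℕ → ℝ
fromℕ n = record
  { L           = _< ι n
  ; U           = ι n <_
  ; L-inhabited = ι n - 1ℚ , p-h<p (ι n) 0<1
  ; U-inhabited = ι n + 1ℚ , p<p+h (ι n) 0<1
  ; L-lower     = <-trans
  ; U-upper     = λ p<q n<p → <-trans n<p p<q
  ; L-open      = λ p<n → let r , p<r , r<n = <-dense p<n in r , p<r , r<n
  ; U-open      = λ n<q → let r , n<r , r<q = <-dense n<q in r , r<q , n<r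
  ; disjoint    = λ p<n n<p → <-asym p<n n<p
  ; located     = loc
  }
  where
  loc : ∀ {p q} → p < q → p < ι n ⊎ ι n < q
  loc {p} {q} p<q with p <? ι n
  ... | yes p<n = inj₁ p<n
  ... | no  p≮n = inj₂ (≤-<-trans (≮⇒≥ p≮n) p<q)

-- The nonnegative k-th root of the natural number m.
root : (k : ℕ) .{{_ : NonZero k}} → ℕ → ℝ
root k m = record
  { L           = Lo
  ; U           = Up
  ; L-inhabited = - 1ℚ , inj₁ (negative⁻¹ (- 1ℚ))
  ; U-inhabited = 1ℚ + ι m , +-mono-<-≤ 0<1 (0≤ι m) , <-≤-trans
      (subst (ι m <_) (+-comm (ι m) 1ℚ) (p<p+h (ι m) 0<1))
      (p≤p^n k (subst (_≤ 1ℚ + ι m) (+-identityʳ 1ℚ) (+-monoʳ-≤ 1ℚ (0≤ι m))))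
  ; L-lower     = lower
  ; U-upper     = λ { p<q (0<p , m<p^k) →
      <-trans 0<p p<q , <-trans m<p^k (^-mono-< k (<⇒≤ 0<p) p<q) }
  ; L-open      = open-L
  ; U-open      = λ { (0<q , m<q^k) → ^-openʳ k 0<q m<q^k }
  ; disjoint    = λ { (inj₁ p<0)   (0<p , _)   → <-asym p<0 0<p
                    ; (inj₂ p^k<m) (_ , m<p^k) → <-asym p^k<m m<p^k }
  ; located     = loc
  }
  where
  Lo Up : ℚ → Set
  Lo q = q < 0ℚ ⊎ q ^ k < ι m
  Up q = 0ℚ < q × ι m < q ^ k

  lower : ∀ {p q} → p < q → Lo q → Lo p
  lower p<q (inj₁ q<0) = inj₁ (<-trans p<q q<0)
  lower {p} p<q (inj₂ q^k<m) with p <? 0ℚ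
  ... | yes p<0 = inj₁ p<0
  ... | no  p≮0 = inj₂ (<-trans (^-mono-< k (≮⇒≥ p≮0) p<q) q^k<m)

  loc : ∀ {p q} → p < q → Lo p ⊎ Up q
  loc {p} {q} p<q with p <? 0ℚ | p ^ k <? ι m
  ... | yes p<0 | _         = inj₁ (inj₁ p<0)
  ... | no  _   | yes p^k<m = inj₁ (inj₂ p^k<m)
  ... | no  p≮0 | no  p^k≮m = inj₂
    (≤-<-trans (≮⇒≥ p≮0) p<q , ≤-<-trans (≮⇒≥ p^k≮m) (^-mono-< k (≮⇒≥ p≮0) p<q))

  open-L : ∀ {p} → Lo p → ∃ λ q → p < q × Lo q
  open-L (inj₁ p<0) = let r , p<r , r<0 = <-dense p<0 in r , p<r , inj₁ r<0
  open-L {p} (inj₂ p^k<m) with p <? 0ℚ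
  ... | yes p<0 = let r , p<r , r<0 = <-dense p<0 in r , p<r , inj₁ r<0
  ... | no  p≮0 = let q , p<q , q^k<m = ^-openˡ k (≮⇒≥ p≮0) p^k<m in q , p<q , inj₂ q^k<m

record Enclosure (x : ℝ) : Set where
  constructor enclosure
  field
    {lo hi} : ℚ
    lo∈L    : L x lo
    hi∈U    : U x hi

open Enclosure

L<U : ∀ x {p q} → L x p → U x q → p < q
L<U x {p} {q} p∈L q∈U with p <? q
... | yes p<q = p<q
... | no  p≮q with <-cmp q p
...   | tri< q<p _ _ = contradiction q∈U (disjoint x (L-lower x q<p p∈L))
...   | tri≈ _ refl _ = contradiction q∈U (disjoint x p∈L)
...   | tri> _ _ p<q = p<q

someEnclosure : ∀ x → Enclosure x
someEnclosure x = enclosure (proj₂ (L-inhabited x)) (proj₂ (U-inhabited x))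

U-upper-≤ : ∀ x {p q} → p ≤ q → U x p → U x q
U-upper-≤ x {p} {q} p≤q p∈U with <-cmp p q
... | tri< p<q _ _ = U-upper x p<q p∈U
... | tri≈ _ refl _ = p∈U
... | tri> _ _ q<p = contradiction refl (λ e → <-irrefl e (<-≤-trans q<p p≤q))

walk : ∀ x {h} → 0ℚ < h → ∀ n {a} → L x a → U x (a + n · h) →
       Σ (Enclosure x) λ I → hi I - lo I ≡ h * (1ℚ + 1ℚ)
walk x 0<h zero {a} a∈L b∈U = contradiction (subst (U x) (+-identityʳ a) b∈U) (disjoint x a∈L)
walk x {h} 0<h (suc n) {a} a∈L b∈U with located x (p<p+h (a + h) 0<h)
... | inj₁ a+h∈L   = walk x 0<h n a+h∈L (subst (U x) (sym (+-assoc a h (n · h))) b∈U)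
... | inj₂ a+h+h∈U = enclosure a∈L a+h+h∈U , width a h
  where
  width : ∀ a h → a + h + h - a ≡ h * (1ℚ + 1ℚ)
  width = solve 2 (λ a h → a :+ h :+ h :- a := h :* (con 1ℚ :+ con 1ℚ)) refl
    where open +-*-Solver

tightEnclosure : ∀ x {δ} → 0ℚ < δ → Σ (Enclosure x) λ I → hi I - lo I ≤ δ
tightEnclosure x {δ} 0<δ = fromStep (small (<⇒≤ (+-mono-< 0<1 0<1)) 0<δ)
  where
  I₀ = someEnclosure x
  a  = lo I₀
  b  = hi I₀
  fromWalk : ∀ {h} → 0ℚ < h → h * (1ℚ + 1ℚ) < δ → (∃ λ n → b - a ≤ n · h) →
             Σ (Enclosure x) λ I → hi I - lo I ≤ δ
  fromWalk {h} 0<h h*2<δ (n , b-a≤n·h) =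
    let I , w = walk x 0<h n (lo∈L I₀) (U-upper-≤ x
                  (subst (_≤ a + n · h) (p+[q-p]≡q a b) (+-monoʳ-≤ a b-a≤n·h)) (hi∈U I₀))
    in I , ≤-trans (≤-reflexive w) (<⇒≤ h*2<δ)
  fromStep : (∃ λ h → 0ℚ < h × h ≤ 1ℚ × h * (1ℚ + 1ℚ) < δ) →
             Σ (Enclosure x) λ I → hi I - lo I ≤ δ
  fromStep (h , 0<h , _ , h*2<δ) = fromWalk 0<h h*2<δ (archimedean 0<h (b - a))

minProduct maxProduct : ℚ → ℚ → ℚ → ℚ → ℚ
minProduct a b c d = ((a * c) ⊓ (a * d)) ⊓ ((b * c) ⊓ (b * d))
maxProduct a b c d = ((a * c) ⊔ (a * d)) ⊔ ((b * c) ⊔ (b * d))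

minCorner maxCorner : ∀ {x y} → Enclosure x → Enclosure y → ℚ
minCorner I J = minProduct (lo I) (hi I) (lo J) (hi J)
maxCorner I J = maxProduct (lo I) (hi I) (lo J) (hi J)

*-between : ∀ r {c s d} → c ≤ s → s ≤ d → (r * c) ⊓ (r * d) ≤ r * s × r * s ≤ r * c ⊔ r * d
*-between r {c} {s} {d} c≤s s≤d with ≤-total 0ℚ r
... | inj₁ 0≤r = p≤q⇒p⊓r≤q (r * d) (*-monoˡ 0≤r c≤s) , p≤q⇒p≤r⊔q (r * c) (*-monoˡ 0≤r s≤d)
... | inj₂ r≤0 = p≤q⇒r⊓p≤q (r * c) (anti s≤d) , p≤q⇒p≤q⊔r (r * d) (anti c≤s)
  where
  anti : ∀ {p q} → p ≤ q → r * q ≤ r * p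
  anti = *-monoˡ-≤-nonPos r {{nonPositive r≤0}}

corners : ∀ {x y} (I : Enclosure x) (J : Enclosure y) {r s} →
          lo I ≤ r → r ≤ hi I → lo J ≤ s → s ≤ hi J →
          minCorner I J ≤ r * s × r * s ≤ maxCorner I J
corners I J {r} {s} a≤r r≤b c≤s s≤d =
  ≤-trans (⊓-mono-≤ (proj₁ at-a) (proj₁ at-b)) (proj₁ along) ,
  ≤-trans (proj₂ along) (⊔-mono-≤ (proj₂ at-a) (proj₂ at-b))
  where
  at-a = *-between (lo I) c≤s s≤d
  at-b = *-between (hi I) c≤s s≤d
  along : (lo I * s) ⊓ (hi I * s) ≤ r * s × r * s ≤ lo I * s ⊔ hi I * s
  along rewrite *-comm (lo I) s | *-comm (hi I) s | *-comm r s = *-between s a≤r r≤b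

p≤p+q : ∀ {p q} → 0ℚ ≤ q → p ≤ p + q
p≤p+q {p} {q} 0≤q = subst (_≤ p + q) (+-identityʳ p) (+-monoʳ-≤ p 0≤q)

p≤q+p : ∀ {p q} → 0ℚ ≤ q → p ≤ q + p
p≤q+p {p} {q} 0≤q = subst (_≤ q + p) (+-identityˡ p) (+-monoˡ-≤ p 0≤q)

infix 4 _∈±_

_∈±_ : ℚ → ℚ → Set
p ∈± K = - K ≤ p × p ≤ K

∈±-weaken : ∀ {p K K′} → K ≤ K′ → p ∈± K → p ∈± K′
∈±-weaken K≤K′ (l , u) = ≤-trans (neg-antimono-≤ K≤K′) l , ≤-trans u K≤K′

∈±-scaled : ∀ {K δ p f} → 0ℚ ≤ K → 0ℚ ≤ f → f ≤ δ → p ∈± K → p * f ∈± K * δ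
∈±-scaled {K} {δ} {p} {f} 0≤K 0≤f f≤δ (l , u) =
  ≤-trans (neg-antimono-≤ (*-monoˡ 0≤K f≤δ))
    (≤-trans (≤-reflexive (neg-distribˡ-* K f)) (*-monoʳ 0≤f l)) ,
  ≤-trans (*-monoʳ 0≤f u) (*-monoˡ 0≤K f≤δ)

∈±-∣∣ : ∀ p → p ∈± ∣ p ∣
∈±-∣∣ p = subst₂ _≤_ (cong -_ (∣-p∣≡∣p∣ p)) (neg-involutive p) (neg-antimono-≤ (p≤∣p∣ (- p))) , p≤∣p∣ p
  where
  p≤∣p∣ : ∀ p → p ≤ ∣ p ∣
  p≤∣p∣ p with ≤-total 0ℚ p
  ... | inj₁ 0≤p = ≤-reflexive (sym (0≤p⇒∣p∣≡p 0≤p))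
  ... | inj₂ p≤0 = ≤-trans p≤0 (0≤∣p∣ p)
  neg-involutive : ∀ p → - (- p) ≡ p
  neg-involutive = solve 1 (λ p → :- (:- p) := p) refl
    where open +-*-Solver

corners-near : ∀ {K δ a b c d} → 0ℚ ≤ K → 0ℚ ≤ δ → δ ≤ 1ℚ → a ∈± K → c ∈± K →
               0ℚ ≤ b - a → b - a ≤ δ → 0ℚ ≤ d - c → d - c ≤ δ →
               let η = δ * (K + K + 1ℚ) in
               a * c - η ≤ minProduct a b c d × maxProduct a b c d ≤ a * c + η
corners-near {K} {δ} {a} {b} {c} {d} 0≤K 0≤δ δ≤1 a∈ c∈ 0≤e e≤δ 0≤f f≤δ =
  ⊓-glb (⊓-glb (proj₁ ac) (proj₁ ad)) (⊓-glb (proj₁ bc) (proj₁ bd)) ,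
  ⊔-lub (⊔-lub (proj₂ ac) (proj₂ ad)) (⊔-lub (proj₂ bc) (proj₂ bd))
  where
  open +-*-Solver
  η = δ * (K + K + 1ℚ)
  Near : ℚ → Set
  Near z = a * c - η ≤ z × z ≤ a * c + η
  η≡ : (K * δ + K * δ) + δ ≡ η
  η≡ = solve 2 (λ K δ → (K :* δ :+ K :* δ) :+ δ := δ :* (K :+ K :+ con 1ℚ)) refl K δ
  -η≡ : - η ≡ (- (K * δ) + - (K * δ)) + - δ
  -η≡ = solve 2 (λ K δ → :- (δ :* (K :+ K :+ con 1ℚ)) := (:- (K :* δ) :+ :- (K :* δ)) :+ :- δ) refl K δ
  near : ∀ {u v w} → u ∈± K * δ → v ∈± K * δ → 0ℚ ≤ w → w ≤ δ → Near (a * c + ((u + v) + w))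
  near (u-lo , u-hi) (v-lo , v-hi) 0≤w w≤δ =
    +-monoʳ-≤ (a * c) (≤-trans (≤-reflexive -η≡)
      (+-mono-≤ (+-mono-≤ u-lo v-lo) (≤-trans (neg-antimono-≤ 0≤δ) 0≤w))) ,
    +-monoʳ-≤ (a * c) (≤-trans (+-mono-≤ (+-mono-≤ u-hi v-hi) w≤δ) (≤-reflexive η≡))
  0∈ : 0ℚ ∈± K * δ
  0∈ = neg-antimono-≤ (0≤* 0≤K 0≤δ) , 0≤* 0≤K 0≤δ
  af∈ : a * (d - c) ∈± K * δ
  af∈ = ∈±-scaled 0≤K 0≤f f≤δ a∈
  ce∈ : c * (b - a) ∈± K * δ
  ce∈ = ∈±-scaled 0≤K 0≤e e≤δ c∈
  ef≤δ : (b - a) * (d - c) ≤ δ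
  ef≤δ = ≤-trans (*-monoˡ 0≤e (≤-trans f≤δ δ≤1)) (≤-trans (≤-reflexive (*-identityʳ (b - a))) e≤δ)
  ac : Near (a * c)
  ac = subst Near (+-identityʳ (a * c)) (near 0∈ 0∈ ≤-refl 0≤δ)
  ad : Near (a * d)
  ad = subst Near
    (solve 3 (λ a c d → a :* c :+ ((a :* (d :- c) :+ con 0ℚ) :+ con 0ℚ) := a :* d) refl a c d)
    (near af∈ 0∈ ≤-refl 0≤δ)
  bc : Near (b * c)
  bc = subst Near
    (solve 3 (λ a b c → a :* c :+ ((con 0ℚ :+ c :* (b :- a)) :+ con 0ℚ) := b :* c) refl a b c)
    (near 0∈ ce∈ ≤-refl 0≤δ)
  bd : Near (b * d)
  bd = subst Near
    (solve 4 (λ a b c d → a :* c :+ ((a :* (d :- c) :+ c :* (b :- a)) :+ (b :- a) :* (d :- c))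
                       := b :* d) refl a b c d)
    (near af∈ ce∈ (0≤* 0≤e 0≤f) ef≤δ)

sizeBound : ∀ x → ∃ λ K → 0ℚ ≤ K × ((I : Enclosure x) → hi I - lo I ≤ 1ℚ → lo I ∈± K)
sizeBound x = K , 0≤+ (0≤∣p∣ p) (0≤∣p∣ q) , λ I w →
  ≤-trans (proj₁ (∈±-weaken (p≤p+q (0≤∣p∣ q)) (∈±-∣∣ p))) (p≤lo I w) ,
  ≤-trans (<⇒≤ (L<U x (lo∈L I) (hi∈U I₀))) (proj₂ (∈±-weaken (p≤q+p (0≤∣p∣ p)) (∈±-∣∣ q)))
  where
  I₀ = someEnclosure x
  p = lo I₀ - 1ℚ
  q = hi I₀
  K = ∣ p ∣ + ∣ q ∣
  cancel : ∀ b a → b - (b - a) ≡ a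
  cancel = solve 2 (λ b a → b :- (b :- a) := a) refl
    where open +-*-Solver
  p≤lo : (I : Enclosure x) → hi I - lo I ≤ 1ℚ → p ≤ lo I
  p≤lo I w = subst (p ≤_) (cancel (hi I) (lo I))
    (+-mono-≤ (<⇒≤ (L<U x (lo∈L I₀) (hi∈U I))) (neg-antimono-≤ w))

NarrowProduct : ℝ → ℝ → ℚ → Set
NarrowProduct x y ε = Σ (Enclosure x) λ I → Σ (Enclosure y) λ J → ∃ λ η → η + η < ε ×
  lo I * lo J - η ≤ minCorner I J × maxCorner I J ≤ lo I * lo J + η

narrowProduct : ∀ x y {ε} → 0ℚ < ε → NarrowProduct x y ε
narrowProduct x y {ε} 0<ε = fromBounds (sizeBound x) (sizeBound y)
  where
  SizeBound : ℝ → ℚ → Set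
  SizeBound z K = 0ℚ ≤ K × ((I : Enclosure z) → hi I - lo I ≤ 1ℚ → lo I ∈± K)
  fromWidth : ∀ {Kx Ky δ} → SizeBound x Kx → SizeBound y Ky → 0ℚ < δ → δ ≤ 1ℚ →
              let C = (Kx + Ky) + (Kx + Ky) + 1ℚ in δ * (C + C) < ε →
              (Σ (Enclosure x) λ I → hi I - lo I ≤ δ) →
              (Σ (Enclosure y) λ J → hi J - lo J ≤ δ) → NarrowProduct x y ε
  fromWidth {Kx} {Ky} {δ} (0≤Kx , boundx) (0≤Ky , boundy) 0<δ δ≤1 δ*2C<ε (I , wI) (J , wJ) =
    I , J , δ * C , subst (_< ε) (*-distribˡ-+ δ C C) δ*2C<ε ,
    corners-near {Kx + Ky} {δ} {lo I} {hi I} {lo J} {hi J} (0≤+ 0≤Kx 0≤Ky) (<⇒≤ 0<δ) δ≤1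
      (∈±-weaken (p≤p+q 0≤Ky) (boundx I (≤-trans wI δ≤1)))
      (∈±-weaken (p≤q+p 0≤Kx) (boundy J (≤-trans wJ δ≤1)))
      (<⇒≤ (p<q⇒0<q-p (L<U x (lo∈L I) (hi∈U I)))) wI
      (<⇒≤ (p<q⇒0<q-p (L<U y (lo∈L J) (hi∈U J)))) wJ
    where
    C = (Kx + Ky) + (Kx + Ky) + 1ℚ
  fromBounds : ∃ (SizeBound x) → ∃ (SizeBound y) → NarrowProduct x y ε
  fromBounds (Kx , bx@(0≤Kx , _)) (Ky , by@(0≤Ky , _)) = fromSmall (small (0≤+ 0≤C 0≤C) 0<ε)
    where
    C = (Kx + Ky) + (Kx + Ky) + 1ℚ
    0≤K : 0ℚ ≤ Kx + Ky
    0≤K = 0≤+ 0≤Kx 0≤Ky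
    0≤C : 0ℚ ≤ C
    0≤C = 0≤+ (0≤+ 0≤K 0≤K) (<⇒≤ 0<1)
    fromSmall : (∃ λ δ → 0ℚ < δ × δ ≤ 1ℚ × δ * (C + C) < ε) → NarrowProduct x y ε
    fromSmall (δ , 0<δ , δ≤1 , δ*2C<ε) =
      fromWidth bx by 0<δ δ≤1 δ*2C<ε (tightEnclosure x 0<δ) (tightEnclosure y 0<δ)

-- Interval multiplication: the product lies above q when q is below all
-- four products of endpoints of some rational enclosures of x and y.
infixl 7 _*ℝ_

_*ℝ_ : ℝ → ℝ → ℝ
x *ℝ y = record
  { L           = Lo
  ; U           = Up
  ; L-inhabited = minCorner I₀ J₀ - 1ℚ , I₀ , J₀ , p-h<p _ 0<1
  ; U-inhabited = maxCorner I₀ J₀ + 1ℚ , I₀ , J₀ , p<p+h _ 0<1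
  ; L-lower     = λ { p<q (I , J , q<) → I , J , <-trans p<q q< }
  ; U-upper     = λ { p<q (I , J , <p) → I , J , <-trans <p p<q }
  ; L-open      = λ { (I , J , p<) → let r , p<r , r< = <-dense p< in r , p<r , I , J , r< }
  ; U-open      = λ { (I , J , <q) → let r , <r , r<q = <-dense <q in r , r<q , I , J , <r }
  ; disjoint    = disj
  ; located     = loc
  }
  where
  Lo Up : ℚ → Set
  Lo q = Σ (Enclosure x) λ I → Σ (Enclosure y) λ J → q < minCorner I J
  Up q = Σ (Enclosure x) λ I → Σ (Enclosure y) λ J → maxCorner I J < q
  I₀ = someEnclosure x
  J₀ = someEnclosure y

  disj : ∀ {p} → Lo p → Up p → ⊥
  disj (I , J , p<) (I′ , J′ , <p) = <-irrefl refl
    (<-trans p< (≤-<-trans (≤-trans (proj₁ (at I J (p≤p⊔q (lo I) (lo I′)) (p≤p⊔q (lo J) (lo J′))))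
                                    (proj₂ (at I′ J′ (p≤q⊔p (lo I) (lo I′)) (p≤q⊔p (lo J) (lo J′))))) <p))
    where
    r = lo I ⊔ lo I′
    s = lo J ⊔ lo J′
    below : ∀ z (M N O : Enclosure z) → lo M ⊔ lo N ≤ hi O
    below z M N O = ⊔-lub (<⇒≤ (L<U z (lo∈L M) (hi∈U O))) (<⇒≤ (L<U z (lo∈L N) (hi∈U O)))
    at : ∀ I″ J″ → lo I″ ≤ r → lo J″ ≤ s → minCorner I″ J″ ≤ r * s × r * s ≤ maxCorner I″ J″
    at I″ J″ ≤r ≤s = corners I″ J″ ≤r (below x I I′ I″) ≤s (below y J J′ J″)

  loc : ∀ {p q} → p < q → Lo p ⊎ Up q
  loc {p} {q} p<q = decide (narrowProduct x y (p<q⇒0<q-p p<q))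
    where
    open +-*-Solver
    shift : ∀ m η → m + η ≡ (m - η) + (η + η)
    shift = solve 2 (λ m η → m :+ η := (m :- η) :+ (η :+ η)) refl
    decide : NarrowProduct x y (q - p) → Lo p ⊎ Up q
    decide (I , J , η , 2η<ε , lower , upper) with p <? lo I * lo J - η
    ... | yes p<m-η = inj₁ (I , J , <-≤-trans p<m-η lower)
    ... | no  p≮m-η = inj₂ (I , J , ≤-<-trans upper m+η<q)
      where
      open ≤-Reasoning
      m+η<q : lo I * lo J + η < q
      m+η<q = begin-strict
        lo I * lo J + η                ≡⟨ shift (lo I * lo J) η ⟩
        (lo I * lo J - η) + (η + η)    ≤⟨ +-monoˡ-≤ (η + η) (≮⇒≥ p≮m-η) ⟩
        p + (η + η)                    <⟨ +-monoʳ-< p 2η<ε ⟩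
        p + (q - p)                    ≡⟨ p+[q-p]≡q p q ⟩
        q                              ∎

-- The real power a^(p/q), the q-th root of a^p.
infix 8 _^[_÷_]

_^[_÷_] : ℕ → ℕ → (q : ℕ) .{{_ : NonZero q}} → ℝ
a ^[ p ÷ q ] = root q (a ℕ.^ p)

Matrix : ℕ → Set
Matrix m = Fin m → Fin m → ℕ

-- Every permutation of Fin (suc m) arises from exactly one pair of an
-- image j of zero and a permutation of the remaining m elements.
permutations : ∀ m → List (Permutation′ m)
permutations zero    = Perm.id ∷ []
permutations (suc m) = concatMap (λ j → map (Perm.insert zero j) (permutations m)) (allFin (suc m))

permutations-complete : ∀ {m} (π : Permutation′ m) → Any (Perm._≈_ π) (permutations m)
permutations-complete {zero}  π = here λ ()
permutations-complete {suc m} π =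
  Any.concatMap⁺ _ (Any.map extend (∈-allFin (π ⟨$⟩ʳ zero)))
  where
  insert-≈ : ∀ j {ρ σ : Permutation′ m} → ρ Perm.≈ σ → Perm.insert zero j ρ Perm.≈ Perm.insert zero j σ
  insert-≈ j ρ≈σ zero    = refl
  insert-≈ j ρ≈σ (suc i) = cong (punchIn j) (ρ≈σ i)
  extend : ∀ {j} → π ⟨$⟩ʳ zero ≡ j → Any (Perm._≈_ π) (map (Perm.insert zero j) (permutations m))
  extend refl = Any.map⁺ (Any.map
    (λ ρ≈σ i → trans (sym (Perm.insert-remove zero π i)) (insert-≈ (π ⟨$⟩ʳ zero) ρ≈σ i))
    (permutations-complete (Perm.remove zero π)))

permutations-unique : ∀ m → AllPairs (λ π ρ → ¬ (π Perm.≈ ρ)) (permutations m)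
permutations-unique zero    = [] ∷ []
permutations-unique (suc m) = AllPairs.concat⁺
  (All.map⁺ (All.universal (λ j → AllPairs.map⁺ (AllPairs.map
    (λ π≉ρ eq → π≉ρ λ i → punchIn-injective j _ _ (eq (suc i)))
    (permutations-unique m))) (allFin (suc m))))
  (AllPairs.map⁺ (AllPairs.map
    (λ j≢k → All.map⁺ (All.universal (λ _ →
               All.map⁺ (All.universal (λ _ eq → j≢k (eq zero)) _)) _))
    (allFin⁺ (suc m))))

per : ∀ {m} → Matrix m → ℕ
per {m} A = sum (map (λ π → product (map (λ i → A i (π ⟨$⟩ʳ i)) (allFin m))) (permutations m))

record Graph (m : ℕ) : Set where
  field
    edge      : Fin m → Fin m → Bool
    symmetric : ∀ u v → edge u v ≡ edge v u
    loopless  : ∀ v → edge v v ≡ false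

open Graph

Digraph : ℕ → Set
Digraph m = Fin m → Fin m → Bool

adjacency : ∀ {m} → Digraph m → Matrix m
adjacency D u v = if D u v then 1 else 0

-- D has only arcs along edges of G, and each edge carries exactly one of
-- its two possible arcs.
record IsOrientation {m} (G : Graph m) (D : Digraph m) : Set where
  field
    arcs-along-edges : ∀ u v → T (D u v) → T (edge G u v)
    one-direction    : ∀ u v → T (edge G u v) → D v u ≡ not (D u v)

K_,_ : ∀ m n → Graph (m ℕ.+ n)
K m , n = record
  { edge      = λ u v → left u xor left v
  ; symmetric = λ u v → xor-comm (left u) (left v)
  ; loopless  = λ v → xor-same (left v)
  }
  where
  left : Fin (m ℕ.+ n) → Bool
  left v = [ const true , const false ]′ (splitAt m v)

record 𝒟 (n : ℕ) : Set where
  field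
    digraph       : Digraph (n ℕ.+ n)
    isOrientation : IsOrientation (K n , n) digraph

A[_] : ∀ {n} → 𝒟 n → Matrix (n ℕ.+ n)
A[ D ] = adjacency (𝒟.digraph D)

-- ⌈M/N⌉ = ⌊(M + N - 1)/N⌋
⌊_/_⌋ ⌈_/_⌉ : ℕ → (N : ℕ) .{{_ : NonZero N}} → ℕ
⌊ M / N ⌋ = M ℕ./ N
⌈ M / N ⌉ = (M ℕ.+ (N ∸ 1)) ℕ./ N

-- ω[2× N , M ] is ω(2N, M). Neither truncated subtraction ever truncates:
-- N⌊M/N⌋ ≤ M, and α = M mod N < N.
ω[2×_,_] : ∀ N M → 0 ℕ.< N → N ℕ.≤ M → ℝ
ω[2× N , M ] 0<N N≤M =
  (⌊ M / N ⌋ !) ^[ N ∸ α ÷ ⌊ M / N ⌋ ] *ℝ (⌈ M / N ⌉ !) ^[ α ÷ ⌈ M / N ⌉ ]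
  where
  instance
    N-nonZero : NonZero N
    N-nonZero = ℕ.>-nonZero 0<N
  α = M ∸ N ℕ.* ⌊ M / N ⌋
  instance
    ⌊⌋-nonZero : NonZero ⌊ M / N ⌋
    ⌊⌋-nonZero = ℕ.>-nonZero (ℕ.m≥n⇒m/n>0 N≤M)
    ⌈⌉-nonZero : NonZero ⌈ M / N ⌉
    ⌈⌉-nonZero = ℕ.>-nonZero (ℕ.m≥n⇒m/n>0 (ℕ.≤-trans N≤M (ℕ.m≤m+n M (N ∸ 1))))

0<2n : ∀ {n} → 2 ℕ.≤ n → 0 ℕ.< 2 ℕ.* n
0<2n {suc n} _ = ℕ.s≤s ℕ.z≤n

2n≤n² : ∀ {n} → 2 ℕ.≤ n → 2 ℕ.* n ℕ.≤ n ℕ.^ 2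
2n≤n² {n} 2≤n = subst (2 ℕ.* n ℕ.≤_) (cong (n ℕ.*_) (sym (ℕ.*-identityʳ n))) (ℕ.*-monoˡ-≤ n 2≤n)

{-# OPTIONS --safe #-}

-- The arcs of an orientation D of K n , n number n², so by Brègman's theorem per A[ D ] is at most
-- the product of (r !) ^ (1 / r) over 2 n out-degrees r of sum n². Since r ↦ (r !) ^ (1 / r) is
-- log-concave, this product is largest when the out-degrees are as equal as possible, which gives
-- ω(4n, n²). For even n, halve both sides and direct the arcs cyclically through the four halves:
-- A[ D ] then consists of four all-ones blocks of order n / 2.
--
-- Roots are avoided by raising to a power K divisible by all degrees involved. Brègman's theorem is
-- proved by Schrijver's induction: the convexity of x log x, applied to the expansion of the
-- permanent along each row, bounds per A ^ per A by a product of powers of permanents of minors.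
module Submission where

open import Defs
open import Data.Nat using (ℕ; _*_; _^_; _≤_)
open import Data.Nat.Divisibility using (_∣_)
open import Data.Product using (_×_; Σ-syntax)

open import Algebra.Bundles using (CommutativeRing)
open import Data.Bool.Base using (Bool; true; false; if_then_else_; not; T; _xor_)
open import Data.Bool.Properties using (not-involutive)
open import Data.Empty using (⊥; ⊥-elim)
open import Data.Fin.Base using (Fin; zero; suc; punchIn; _↑ˡ_; _↑ʳ_; splitAt)
open import Data.Fin.Patterns using (0F; 1F; 2F; 3F)
import Data.Fin.Permutation as Perm
import Data.Fin.Properties as Fin
open import Data.List.Base as List using (List; []; _∷_; concatMap; allFin; tabulate)
open import Data.List.Properties using (map-++; map-∘; map-cong; map-tabulate)
open import Data.Nat using (zero; suc; _+_; _∸_; _<_; _!; NonZero; z≤n; s≤s; ≢-nonZero; >-nonZero; >-nonZero⁻¹)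
open import Data.Nat.DivMod
open import Data.Nat.Divisibility using (divides; ∣-trans; m∣m*n; n∣m*n; m≤n⇒m!∣n!)
open import Data.Nat.ListAction using (sum; product)
open import Data.Nat.ListAction.Properties using (sum-++)
open import Data.Nat.Properties
open import Data.Nat.Solver using (module +-*-Solver)
open import Data.Product.Base using (∃; _,_; proj₁; proj₂)
open import Data.Rational.Base as ℚ using (0ℚ; 1ℚ)
import Data.Rational.Properties as ℚ
open import Data.Sum.Base using (_⊎_; inj₁; inj₂; [_,_]′)
open import Function.Base using (_∘_; id; const)
open import Relation.Binary.PropositionalEquality
  using (_≡_; _≢_; refl; sym; trans; cong; cong₂; subst; subst₂; module ≡-Reasoning)
open import Relation.Nullary using (yes; no; contradiction; does)
open import Relation.Nullary.Decidable using (dec-true; dec-false)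

open import Algebra.Definitions.RawSemiring ℚ.+-*-rawSemiring using () renaming (_^_ to _^ℚ_)
open import Algebra.Properties.CommutativeSemiring.Exp
  (CommutativeRing.commutativeSemiring ℚ.+-*-commutativeRing) using ()
  renaming (^-distrib-* to ^ℚ-distrib-*; ^-assocʳ to ^ℚ-assoc)
open import Algebra.Properties.Semiring.Sum +-*-semiring using (*-distribˡ-sum; *-distribʳ-sum; ∑-comm; ∑-distrib-+)
  renaming (sum to ∑; sum-cong-≗ to ∑-cong; sum-remove to ∑-remove)
open import Algebra.Properties.CommutativeMonoid.Sum *-1-commutativeMonoid using ()
  renaming (sum to ∏; sum-cong-≗ to ∏-cong; sum-remove to ∏-remove; ∑-comm to ∏-comm; ∑-distrib-+ to ∏-distrib-*)

-- Products of Dedekind reals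

-- Expanding along a single row would not close the induction: how far a deletion lowers the degrees
-- of the other rows depends on the chosen column. Multiplying the bounds of all rows repairs this.
-- Each row then meets every deletion of another row together with a column, and the row and column
-- expansions of the permanent give the exponents exactly, so nothing is lost outside the convexity
-- estimate and the induction hypothesis. A row without ones has no meaningful factor (0!)^(1/0),
-- and log-concavity starts at r = 1. A digraph with such a row has permanent 0 and is set aside
-- before the out-degrees are balanced. The target is a product of two roots of different orders,
-- given by cuts. These are touched only through products of rational bounds on the two roots; what
-- remains is an inequality of natural numbers between p^K and some X^u * Y^v.

ι-+ : ∀ m n → ι (m + n) ≡ ι m ℚ.+ ι n
ι-+ zero    n = sym (ℚ.+-identityˡ (ι n))
ι-+ (suc m) n = begin
  ι (suc (m + n))            ≡⟨ ι-suc (m + n) ⟩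
  1ℚ ℚ.+ ι (m + n)           ≡⟨ cong (λ z → 1ℚ ℚ.+ z) (ι-+ m n) ⟩
  1ℚ ℚ.+ (ι m ℚ.+ ι n)       ≡⟨ ℚ.+-assoc 1ℚ (ι m) (ι n) ⟨
  1ℚ ℚ.+ ι m ℚ.+ ι n         ≡⟨ cong (ℚ._+ ι n) (ι-suc m) ⟨
  ι (suc m) ℚ.+ ι n          ∎
  where open ≡-Reasoning

ι-* : ∀ m n → ι (m * n) ≡ ι m ℚ.* ι n
ι-* zero    n = sym (ℚ.*-zeroˡ (ι n))
ι-* (suc m) n = begin
  ι (n + m * n)                   ≡⟨ ι-+ n (m * n) ⟩
  ι n ℚ.+ ι (m * n)               ≡⟨ cong₂ ℚ._+_ (sym (ℚ.*-identityˡ (ι n))) (ι-* m n) ⟩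
  1ℚ ℚ.* ι n ℚ.+ ι m ℚ.* ι n      ≡⟨ ℚ.*-distribʳ-+ (ι n) 1ℚ (ι m) ⟨
  (1ℚ ℚ.+ ι m) ℚ.* ι n            ≡⟨ cong (ℚ._* ι n) (ι-suc m) ⟨
  ι (suc m) ℚ.* ι n               ∎
  where open ≡-Reasoning

ι-^ : ∀ m k → ι (m ^ k) ≡ ι m ^ℚ k
ι-^ m zero    = refl
ι-^ m (suc k) = trans (ι-* m (m ^ k)) (cong (ι m ℚ.*_) (ι-^ m k))

ι-mono-≤ : ∀ {m n} → m ≤ n → ι m ℚ.≤ ι n
ι-mono-≤ {m} {n} m≤n = subst (λ z → ι m ℚ.≤ ι z) (m+[n∸m]≡n m≤n)
  (subst (ι m ℚ.≤_) (sym (ι-+ m (n ∸ m))) (p≤p+q (0≤ι (n ∸ m))))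

*-mono-≤-nonNeg : ∀ {p q r s} → 0ℚ ℚ.≤ p → 0ℚ ℚ.≤ r → p ℚ.≤ q → r ℚ.≤ s → p ℚ.* r ℚ.≤ q ℚ.* s
*-mono-≤-nonNeg 0≤p 0≤r p≤q r≤s = ℚ.≤-trans (*-monoˡ 0≤p r≤s) (*-monoʳ (ℚ.≤-trans 0≤r r≤s) p≤q)

open Enclosure

-- Locatedness replaces the search for suitable enclosures. For q < r < p, either q is already below
-- the product or r is above it; the latter fails because `hi I * hi J` is at least p and at most
-- `maxCorner I J`.
≤-*ℝ : ∀ {x y p} → (∀ {s t} → ℝ.U x s → ℝ.U y t → ι p ℚ.≤ s ℚ.* t) → fromℕ p ≤ℝ x *ℝ y
≤-*ℝ {x} {y} {p} bound q q<p = let r , q<r , r<p = ℚ.<-dense q<p in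
  [ id , (λ r∈U → ⊥-elim (ℚ.<-irrefl refl (ℚ.<-trans r<p (U-above r∈U)))) ]′ (ℝ.located (x *ℝ y) q<r)
  where
  U-above : ∀ {r} → ℝ.U (x *ℝ y) r → ι p ℚ.< r
  U-above (I , J , max<r) = ℚ.≤-<-trans (bound (hi∈U I) (hi∈U J)) (ℚ.≤-<-trans
    (proj₂ (corners I J {hi I} {hi J} (ℚ.<⇒≤ (L<U x (lo∈L I) (hi∈U I))) ℚ.≤-refl (ℚ.<⇒≤ (L<U y (lo∈L J) (hi∈U J))) ℚ.≤-refl))
    max<r)

-- If p < `minCorner I J`, the corners that pair a lower endpoint with a positive upper one exceed
-- p, so both lower endpoints are nonnegative. Hence the bound is asked for nonnegative s and t
-- only.
*ℝ-≤ : ∀ {x y p} → (∀ {s} → ℝ.U x s → 0ℚ ℚ.< s) → (∀ {t} → ℝ.U y t → 0ℚ ℚ.< t) →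
       (∀ {s t} → 0ℚ ℚ.≤ s → 0ℚ ℚ.≤ t → ℝ.L x s → ℝ.L y t → s ℚ.* t ℚ.≤ ι p) → x *ℝ y ≤ℝ fromℕ p
*ℝ-≤ {x} {y} {p} 0<x 0<y bound q (I , J , q<min) = ℚ.≰⇒> λ p≤q → absurd (ℚ.≤-<-trans p≤q q<min)
  where
  lo≤hi-x = ℚ.<⇒≤ (L<U x (lo∈L I) (hi∈U I))
  lo≤hi-y = ℚ.<⇒≤ (L<U y (lo∈L J) (hi∈U J))
  0≤left : ∀ {a b} → 0ℚ ℚ.< b → ι p ℚ.< a ℚ.* b → 0ℚ ℚ.≤ a
  0≤left {a} {b} 0<b p<ab = ℚ.≮⇒≥ λ a<0 → ℚ.<-irrefl refl (ℚ.≤-<-trans (0≤ι p)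
    (ℚ.<-≤-trans p<ab (subst (a ℚ.* b ℚ.≤_) (ℚ.*-zeroˡ b) (*-monoʳ (ℚ.<⇒≤ 0<b) (ℚ.<⇒≤ a<0)))))
  absurd : ι p ℚ.< minCorner I J → ⊥
  absurd p<min = ℚ.<-irrefl refl (ℚ.<-≤-trans p<st (bound 0≤s 0≤t (lo∈L I) (lo∈L J)))
    where
    p<st : ι p ℚ.< lo I ℚ.* lo J
    p<st = ℚ.<-≤-trans p<min (proj₁ (corners I J {lo I} {lo J} ℚ.≤-refl lo≤hi-x ℚ.≤-refl lo≤hi-y))
    0≤s : 0ℚ ℚ.≤ lo I
    0≤s = 0≤left (0<y (hi∈U J)) (ℚ.<-≤-trans p<min
      (proj₁ (corners I J {lo I} {hi J} ℚ.≤-refl lo≤hi-x lo≤hi-y ℚ.≤-refl)))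
    0≤t : 0ℚ ℚ.≤ lo J
    0≤t = 0≤left (0<x (hi∈U I)) (subst (ι p ℚ.<_) (ℚ.*-comm (hi I) (lo J)) (ℚ.<-≤-trans p<min
      (proj₁ (corners I J {hi I} {lo J} lo≤hi-x ℚ.≤-refl ℚ.≤-refl lo≤hi-y))))

module _ (k c : ℕ) {K u v X Y p : ℕ} (0<K : 0 < K) (u*k≡K : u * k ≡ K) (v*c≡K : v * c ≡ K) where
  open ℚ.≤-Reasoning
  private
    instance
      K≢0 : NonZero K
      K≢0 = >-nonZero 0<K

    ι-powers : ι (X ^ u * Y ^ v) ≡ ι X ^ℚ u ℚ.* ι Y ^ℚ v
    ι-powers = trans (ι-* (X ^ u) (Y ^ v)) (cong₂ ℚ._*_ (ι-^ X u) (ι-^ Y v))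

    product-powers : ∀ s t → (s ^ℚ k) ^ℚ u ℚ.* (t ^ℚ c) ^ℚ v ≡ (s ℚ.* t) ^ℚ K
    product-powers s t = trans
      (cong₂ ℚ._*_ (trans (^ℚ-assoc s k u) (cong (s ^ℚ_) (trans (*-comm k u) u*k≡K)))
                   (trans (^ℚ-assoc t c v) (cong (t ^ℚ_) (trans (*-comm c v) v*c≡K))))
      (sym (^ℚ-distrib-* s t K))

  -- Since k * u = c * v = K, the number `X ^ u * Y ^ v` is the K-th power of X^(1/k) * Y^(1/c).
  -- This lemma and the next thus compare p with a product of two roots without forming either root.
  ≤-product-above : p ^ K ≤ X ^ u * Y ^ v → ∀ {s t} → 0ℚ ℚ.≤ s → 0ℚ ℚ.≤ t →
                    ι X ℚ.≤ s ^ℚ k → ι Y ℚ.≤ t ^ℚ c → ι p ℚ.≤ s ℚ.* t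
  ≤-product-above p^K≤ {s} {t} 0≤s 0≤t X≤s^k Y≤t^c = ℚ.≮⇒≥ λ st<p → ℚ.<-irrefl refl (begin-strict
    (s ℚ.* t) ^ℚ K                         <⟨ ^-mono-< K (0≤* 0≤s 0≤t) st<p ⟩
    ι p ^ℚ K                               ≡⟨ ι-^ p K ⟨
    ι (p ^ K)                              ≤⟨ ι-mono-≤ p^K≤ ⟩
    ι (X ^ u * Y ^ v)                      ≡⟨ ι-powers ⟩
    ι X ^ℚ u ℚ.* ι Y ^ℚ v
      ≤⟨ *-mono-≤-nonNeg (^-nonNeg u (0≤ι X)) (^-nonNeg v (0≤ι Y)) (^-mono-≤ u (0≤ι X) X≤s^k) (^-mono-≤ v (0≤ι Y) Y≤t^c) ⟩
    (s ^ℚ k) ^ℚ u ℚ.* (t ^ℚ c) ^ℚ v        ≡⟨ product-powers s t ⟩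
    (s ℚ.* t) ^ℚ K                         ∎)

  product-below-≤ : X ^ u * Y ^ v ≤ p ^ K → ∀ {s t} → 0ℚ ℚ.≤ s → 0ℚ ℚ.≤ t →
                    s ^ℚ k ℚ.≤ ι X → t ^ℚ c ℚ.≤ ι Y → s ℚ.* t ℚ.≤ ι p
  product-below-≤ ≤p^K {s} {t} 0≤s 0≤t s^k≤X t^c≤Y = ℚ.≮⇒≥ λ p<st → ℚ.<-irrefl refl (begin-strict
    ι p ^ℚ K                               <⟨ ^-mono-< K (0≤ι p) p<st ⟩
    (s ℚ.* t) ^ℚ K                         ≡⟨ product-powers s t ⟨
    (s ^ℚ k) ^ℚ u ℚ.* (t ^ℚ c) ^ℚ v
      ≤⟨ *-mono-≤-nonNeg (^-nonNeg u (^-nonNeg k 0≤s)) (^-nonNeg v (^-nonNeg c 0≤t))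
           (^-mono-≤ u (^-nonNeg k 0≤s) s^k≤X) (^-mono-≤ v (^-nonNeg c 0≤t) t^c≤Y) ⟩
    ι X ^ℚ u ℚ.* ι Y ^ℚ v                  ≡⟨ ι-powers ⟨
    ι (X ^ u * Y ^ v)                      ≤⟨ ι-mono-≤ ≤p^K ⟩
    ι (p ^ K)                              ≡⟨ ι-^ p K ⟩
    ι p ^ℚ K                               ∎)

L-root⇒≤ : ∀ {k m s} .{{_ : NonZero k}} → 0ℚ ℚ.≤ s → ℝ.L (root k m) s → s ^ℚ k ℚ.≤ ι m
L-root⇒≤ 0≤s (inj₁ s<0)   = ⊥-elim (ℚ.<-irrefl refl (ℚ.≤-<-trans 0≤s s<0))
L-root⇒≤ 0≤s (inj₂ s^k<m) = ℚ.<⇒≤ s^k<m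

open +-*-Solver
open ≤-Reasoning

-- Convexity of x log x

^-distrib-* : ∀ m n k → (m * n) ^ k ≡ m ^ k * n ^ k
^-distrib-* m n zero    = refl
^-distrib-* m n (suc k) = trans (cong (m * n *_) (^-distrib-* m n k))
  (solve 4 (λ m n M N → m :* n :* (M :* N) := m :* M :* (n :* N)) refl m n (m ^ k) (n ^ k))

2mn≤m²+n² : ∀ m n → 2 * (m * n) ≤ m * m + n * n
2mn≤m²+n² m n = [ ordered , (λ n≤m → subst₂ _≤_ (cong (2 *_) (*-comm n m)) (+-comm (n * n) (m * m)) (ordered n≤m)) ]′
  (≤-total m n)
  where
  ordered : ∀ {m n} → m ≤ n → 2 * (m * n) ≤ m * m + n * n
  ordered {m} {n} m≤n = subst (λ n → 2 * (m * n) ≤ m * m + n * n) (m+[n∸m]≡n m≤n) (begin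
    2 * (m * (m + d))              ≤⟨ m≤m+n _ (d * d) ⟩
    2 * (m * (m + d)) + d * d      ≡⟨ solve 2 (λ m d → con 2 :* (m :* (m :+ d)) :+ d :* d
                                       := m :* m :+ (m :+ d) :* (m :+ d)) refl m d ⟩
    m * m + (m + d) * (m + d)      ∎)
    where d = n ∸ m

-- v ^ (n + 1) lies above its tangent at u, with both sides moved so that no subtraction occurs.
tangent-^ : ∀ n u v → suc n * (u ^ n * v) ≤ v ^ suc n + n * u ^ suc n
tangent-^ zero    u v = ≤-reflexive (solve 1 (λ v → con 1 :* (con 1 :* v) := v :* con 1 :+ con 0) refl v)
tangent-^ (suc n) u v = +-cancelʳ-≤ (suc n * (U * (v * v)) + n * (u * U * v)) _ _ (begin
  suc (suc n) * (u * U * v) + (suc n * (U * (v * v)) + n * (u * U * v))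
    ≡⟨ solve 4 (λ n u v U → (con 2 :+ n) :* (u :* U :* v) :+ ((con 1 :+ n) :* (U :* (v :* v)) :+ n :* (u :* U :* v))
        := v :* ((con 1 :+ n) :* (U :* v)) :+ (con 1 :+ n) :* U :* (con 2 :* (u :* v))) refl n u v U ⟩
  v * (suc n * (U * v)) + suc n * U * (2 * (u * v))
    ≤⟨ +-mono-≤ (*-monoʳ-≤ v (tangent-^ n u v)) (*-monoʳ-≤ (suc n * U) (2mn≤m²+n² u v)) ⟩
  v * (V + n * (u * U)) + suc n * U * (u * u + v * v)
    ≡⟨ solve 5 (λ n u v U V → v :* (V :+ n :* (u :* U)) :+ (con 1 :+ n) :* U :* (u :* u :+ v :* v)
        := v :* V :+ (con 1 :+ n) :* (u :* (u :* U)) :+ ((con 1 :+ n) :* (U :* (v :* v)) :+ n :* (u :* U :* v)))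
        refl n u v U V ⟩
  v * V + suc n * (u * (u * U)) + (suc n * (U * (v * v)) + n * (u * U * v)) ∎)
  where
  U = u ^ n
  V = v ^ suc n

-- The tangent at n-fold mean S / n, evaluated at the (n + 1)-fold mean (S + y) / (n + 1).
amgm-step : ∀ n S y → suc n ^ suc n * (y * S ^ n) ≤ n ^ n * (y + S) ^ suc n
amgm-step zero S y = ≤-trans (≤-reflexive (solve 1 (λ y → con 1 :* (y :* con 1) := y) refl y))
  (≤-trans (m≤m+n y S) (≤-reflexive (solve 2 (λ y S → y :+ S := con 1 :* ((y :+ S) :* con 1)) refl y S)))
amgm-step n@(suc _) S y = *-cancelˡ-≤ n (+-cancelʳ-≤ (n * suc n * S * (P * Q)) _ _ (begin
  n * (suc n * Q * (y * P)) + n * suc n * S * (P * Q)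
    ≡⟨ solve 5 (λ n S y P Q → n :* ((con 1 :+ n) :* Q :* (y :* P)) :+ n :* (con 1 :+ n) :* S :* (P :* Q)
         := (con 1 :+ n) :* (P :* Q :* (n :* (y :+ S)))) refl n S y P Q ⟩
  suc n * (P * Q * v)                      ≡⟨ cong (λ z → suc n * (z * v)) (^-distrib-* S (suc n) n) ⟨
  suc n * (u ^ n * v)                      ≤⟨ tangent-^ n u v ⟩
  v ^ suc n + n * u ^ suc n
    ≡⟨ cong₂ (λ z w → z + n * (u * w)) (^-distrib-* n (y + S) (suc n)) (^-distrib-* S (suc n) n) ⟩
  n * n ^ n * R + n * (u * (P * Q))
    ≡⟨ solve 6 (λ n S N R P Q → n :* N :* R :+ n :* (S :* (con 1 :+ n) :* (P :* Q))
         := n :* (N :* R) :+ n :* (con 1 :+ n) :* S :* (P :* Q)) refl n S (n ^ n) R P Q ⟩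
  n * (n ^ n * R) + n * suc n * S * (P * Q) ∎))
  where
  P = S ^ n
  Q = suc n ^ n
  R = (y + S) ^ suc n
  u = S * suc n
  v = n * (y + S)

n^n>0 : ∀ n → 0 < n ^ n
n^n>0 zero      = s≤s z≤n
n^n>0 n@(suc _) = m^n>0 n n

-- Induction on b puts in one copy of y at a time through `amgm-step`, starting from a equal terms
-- x, where equality holds.
weighted-amgm : ∀ a b x y → (b + a) ^ (b + a) * (y ^ b * x ^ a) ≤ (b * y + a * x) ^ (b + a)
weighted-amgm a zero    x y = ≤-reflexive (trans (cong (a ^ a *_) (*-identityˡ (x ^ a))) (sym (^-distrib-* a x a)))
weighted-amgm a (suc b) x y = *-cancelˡ-≤ (n ^ n) {{>-nonZero (n^n>0 n)}} (begin
  n ^ n * (suc n ^ suc n * (y * y ^ b * x ^ a))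
    ≡⟨ solve 5 (λ N M y Y X → N :* (M :* (y :* Y :* X)) := M :* (y :* (N :* (Y :* X)))) refl (n ^ n) (suc n ^ suc n) y (y ^ b) (x ^ a) ⟩
  suc n ^ suc n * (y * (n ^ n * (y ^ b * x ^ a)))
    ≤⟨ *-monoʳ-≤ (suc n ^ suc n) (*-monoʳ-≤ y (weighted-amgm a b x y)) ⟩
  suc n ^ suc n * (y * S ^ n)              ≤⟨ amgm-step n S y ⟩
  n ^ n * (y + S) ^ suc n                  ≡⟨ cong (λ z → n ^ n * z ^ suc n) (+-assoc y (b * y) (a * x)) ⟨
  n ^ n * (suc b * y + a * x) ^ suc n      ∎)
  where
  n = b + a
  S = b * y + a * x

-- In logarithms, (t + S) log ((t + S) / (r + 1)) ≤ t log t + S log (S / r): one more number t joins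
-- r others of sum S. The cases t = 0 and S = 0 stand apart because the main case cancels
-- `t ^ S * S ^ t`.
log-sum₂ : ∀ r t S → (t + S) ^ (t + S) * r ^ S ≤ suc r ^ (t + S) * (t ^ t * S ^ S)
log-sum₂ r zero S = begin
  S ^ S * r ^ S               ≡⟨ *-comm (S ^ S) (r ^ S) ⟩
  r ^ S * S ^ S               ≤⟨ *-mono-≤ (^-monoˡ-≤ S (n≤1+n r)) (≤-reflexive (sym (*-identityˡ (S ^ S)))) ⟩
  suc r ^ S * (1 * S ^ S)     ∎
log-sum₂ r t zero rewrite +-identityʳ t = begin
  t ^ t * 1                   ≡⟨ *-comm (t ^ t) 1 ⟩
  1 * t ^ t                   ≤⟨ *-mono-≤ (m^n>0 (suc r) t) (≤-reflexive (sym (*-identityʳ (t ^ t)))) ⟩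
  suc r ^ t * (t ^ t * 1)     ∎
log-sum₂ r t@(suc _) S@(suc _) =
  *-cancelʳ-≤ _ _ (t ^ S * S ^ t) {{m*n≢0 (t ^ S) (S ^ t) {{m^n≢0 t S}} {{m^n≢0 S t}}}} (begin
  n ^ n * r ^ S * (t ^ S * S ^ t)
    ≡⟨ solve 4 (λ N R T U → N :* R :* (T :* U) := N :* (U :* (R :* T))) refl (n ^ n) (r ^ S) (t ^ S) (S ^ t) ⟩
  n ^ n * (S ^ t * (r ^ S * t ^ S))       ≡⟨ cong (λ z → n ^ n * (S ^ t * z)) (^-distrib-* r t S) ⟨
  -- The means are those of t copies of 1/t and S copies of r/S, all scaled by t * S.
  n ^ n * (S ^ t * (r * t) ^ S)           ≤⟨ weighted-amgm S t (r * t) S ⟩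
  (t * S + S * (r * t)) ^ n
    ≡⟨ cong (_^ n) (solve 3 (λ r t S → t :* S :+ S :* (r :* t) := (con 1 :+ r) :* (t :* S)) refl r t S) ⟩
  (suc r * (t * S)) ^ n                   ≡⟨ ^-distrib-* (suc r) (t * S) n ⟩
  suc r ^ n * (t * S) ^ n                 ≡⟨ cong (suc r ^ n *_) (^-distrib-* t S n) ⟩
  suc r ^ n * (t ^ n * S ^ n)
    ≡⟨ cong₂ (λ z w → suc r ^ n * (z * w)) (^-distribˡ-+-* t t S) (^-distribˡ-+-* S t S) ⟩
  suc r ^ n * (t ^ t * t ^ S * (S ^ t * S ^ S))
    ≡⟨ solve 5 (λ R A B C D → R :* (A :* B :* (C :* D)) := R :* (A :* D) :* (B :* C)) refl (suc r ^ n) (t ^ t) (t ^ S) (S ^ t) (S ^ S) ⟩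
  suc r ^ n * (t ^ t * S ^ S) * (t ^ S * S ^ t) ∎)
  where n = t + S

χ : Bool → ℕ
χ b = if b then 1 else 0

-- Convexity of x log x, exponentiated: (T / r) ^ T ≤ ∏ q k ^ q k, where T is the sum of the
-- r numbers q k selected by b.
log-sum : ∀ {m} (b : Fin m → Bool) (q : Fin m → ℕ) → let T = ∑ (λ k → χ (b k) * q k) in
          T ^ T ≤ ∑ (χ ∘ b) ^ T * ∏ (λ k → q k ^ (χ (b k) * q k))
log-sum {zero}  b q = ≤-refl
log-sum {suc m} b q with b zero | log-sum (b ∘ suc) (q ∘ suc)
... | false | ih = ≤-trans ih (≤-reflexive (cong (r ^ S *_) (sym (*-identityˡ P))))
  where
  S = ∑ (λ k → χ (b (suc k)) * q (suc k))
  r = ∑ (χ ∘ b ∘ suc)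
  P = ∏ (λ k → q (suc k) ^ (χ (b (suc k)) * q (suc k)))
... | true  | ih rewrite +-identityʳ (q zero) = cancel S r P ih
  where
  S = ∑ (λ k → χ (b (suc k)) * q (suc k))
  r = ∑ (χ ∘ b ∘ suc)
  P = ∏ (λ k → q (suc k) ^ (χ (b (suc k)) * q (suc k)))
  t = q zero
  cancel : ∀ S r P → S ^ S ≤ r ^ S * P → (t + S) ^ (t + S) ≤ suc r ^ (t + S) * (t ^ t * P)
  cancel S r P ih = *-cancelʳ-≤ _ _ (r ^ S) {{r^S≢0}} (begin
    (t + S) ^ (t + S) * r ^ S                ≤⟨ log-sum₂ r t S ⟩
    suc r ^ (t + S) * (t ^ t * S ^ S)        ≤⟨ *-monoʳ-≤ (suc r ^ (t + S)) (*-monoʳ-≤ (t ^ t) ih) ⟩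
    suc r ^ (t + S) * (t ^ t * (r ^ S * P))
      ≡⟨ solve 4 (λ R T U P → R :* (T :* (U :* P)) := R :* (T :* P) :* U) refl (suc r ^ (t + S)) (t ^ t) (r ^ S) P ⟩
    suc r ^ (t + S) * (t ^ t * P) * r ^ S    ∎)
    where
    r^S≢0 : NonZero (r ^ S)
    r^S≢0 = m*n≢0⇒m≢0 (r ^ S) {{>-nonZero (≤-trans (n^n>0 S) ih)}}

-- Expansions of the permanent

sum-tabulate : ∀ {n} (f : Fin n → ℕ) → sum (tabulate f) ≡ ∑ f
sum-tabulate {zero}  f = refl
sum-tabulate {suc n} f = cong (f zero +_) (sum-tabulate (f ∘ suc))

product-tabulate : ∀ {n} (f : Fin n → ℕ) → product (tabulate f) ≡ ∏ f
product-tabulate {zero}  f = refl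
product-tabulate {suc n} f = cong (f zero *_) (product-tabulate (f ∘ suc))

sum-allFin : ∀ {n} (f : Fin n → ℕ) → sum (List.map f (allFin n)) ≡ ∑ f
sum-allFin f = trans (cong sum (map-tabulate id f)) (sum-tabulate f)

product-allFin : ∀ {n} (f : Fin n → ℕ) → product (List.map f (allFin n)) ≡ ∏ f
product-allFin f = trans (cong product (map-tabulate id f)) (product-tabulate f)

sum-concatMap : ∀ {A B : Set} (w : B → ℕ) (g : A → List B) xs →
                sum (List.map w (concatMap g xs)) ≡ sum (List.map (λ x → sum (List.map w (g x))) xs)
sum-concatMap w g []       = refl
sum-concatMap w g (x ∷ xs) = begin-equality
  sum (List.map w (g x List.++ concatMap g xs))
    ≡⟨ cong sum (map-++ w (g x) (concatMap g xs)) ⟩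
  sum (List.map w (g x) List.++ List.map w (concatMap g xs))             ≡⟨ sum-++ (List.map w (g x)) _ ⟩
  sum (List.map w (g x)) + sum (List.map w (concatMap g xs))
    ≡⟨ cong (sum (List.map w (g x)) +_) (sum-concatMap w g xs) ⟩
  sum (List.map w (g x)) + sum (List.map (λ x → sum (List.map w (g x))) xs) ∎

sum-map-* : ∀ {A : Set} a (v : A → ℕ) xs → sum (List.map (λ x → a * v x) xs) ≡ a * sum (List.map v xs)
sum-map-* a v []       = sym (*-zeroʳ a)
sum-map-* a v (x ∷ xs) = trans (cong (a * v x +_) (sum-map-* a v xs)) (sym (*-distribˡ-+ a (v x) _))

minor : ∀ {A : Set} {m} → Fin (suc m) → Fin (suc m) → (Fin (suc m) → Fin (suc m) → A) → Fin m → Fin m → A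
minor i j A r c = A (punchIn i r) (punchIn j c)

weight : ∀ {m} → Matrix m → Perm.Permutation′ m → ℕ
weight {m} A π = product (List.map (λ i → A i (π Perm.⟨$⟩ʳ i)) (allFin m))

weight-cong : ∀ {m} {A B : Matrix m} → (∀ i j → A i j ≡ B i j) → ∀ π → weight A π ≡ weight B π
weight-cong A≗B π = cong product (map-cong (λ i → A≗B i _) (allFin _))

per-cong : ∀ {m} {A B : Matrix m} → (∀ i j → A i j ≡ B i j) → per A ≡ per B
per-cong A≗B = cong sum (map-cong (weight-cong A≗B) (permutations _))

weight-insert : ∀ {m} (A : Matrix (suc m)) j π → weight A (Perm.insert zero j π) ≡ A zero j * weight (minor zero j A) π
weight-insert A j π = trans
  (product-allFin (λ i → A i (Perm.insert zero j π Perm.⟨$⟩ʳ i)))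
  (cong (A zero j *_) (sym (product-allFin (λ i → minor zero j A i (π Perm.⟨$⟩ʳ i)))))

per-first-row : ∀ {m} (A : Matrix (suc m)) → per A ≡ ∑ λ j → A zero j * per (minor zero j A)
per-first-row {m} A = begin-equality
  sum (List.map (weight A) (permutations (suc m)))
    ≡⟨ sum-concatMap (weight A) (λ j → List.map (Perm.insert zero j) ps) (allFin (suc m)) ⟩
  sum (List.map (λ j → sum (List.map (weight A) (List.map (Perm.insert zero j) ps))) (allFin (suc m)))
    ≡⟨ sum-allFin (λ j → sum (List.map (weight A) (List.map (Perm.insert zero j) ps))) ⟩
  ∑ (λ j → sum (List.map (weight A) (List.map (Perm.insert zero j) ps)))
    ≡⟨ ∑-cong first-at ⟩
  ∑ (λ j → A zero j * per (minor zero j A)) ∎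
  where
  ps = permutations m
  first-at : ∀ j → sum (List.map (weight A) (List.map (Perm.insert zero j) ps)) ≡ A zero j * per (minor zero j A)
  first-at j = begin-equality
    sum (List.map (weight A) (List.map (Perm.insert zero j) ps))
      ≡⟨ cong sum (map-∘ {g = weight A} {f = Perm.insert zero j} ps) ⟨
    sum (List.map (λ π → weight A (Perm.insert zero j π)) ps)
      ≡⟨ cong sum (map-cong (weight-insert A j) ps) ⟩
    sum (List.map (λ π → A zero j * weight (minor zero j A) π) ps)
      ≡⟨ sum-map-* (A zero j) (weight (minor zero j A)) ps ⟩
    A zero j * per (minor zero j A) ∎

-- Columns k and `punchIn k j` can be deleted in either order: p is the position of k once the other
-- is gone. This identifies minors of minors in `per-column`.
punchIn-swap : ∀ {m} (k : Fin (suc (suc m))) (j : Fin (suc m)) → ∃ λ p →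
               punchIn (punchIn k j) p ≡ k × (∀ c → punchIn (punchIn k j) (punchIn p c) ≡ punchIn k (punchIn j c))
punchIn-swap         zero    j       = zero , refl , λ _ → refl
punchIn-swap         (suc k) zero    = k , refl , λ _ → refl
punchIn-swap {suc m} (suc k) (suc j) with punchIn-swap k j
... | p , eq , eqs = suc p , cong suc eq , λ { zero → refl ; (suc c) → cong suc (eqs c) }

-- Expansion along row zero splits off the entry in column k, which is the term i = 0. Every other
-- minor still contains column k, is expanded along it by induction, and the two sums are exchanged.
per-column : ∀ {m} (A : Matrix (suc m)) k → per A ≡ ∑ λ i → A i k * per (minor i k A)
per-column {zero}  A zero = per-first-row A
per-column {suc m} A k    = begin-equality
  per A
    ≡⟨ per-first-row A ⟩
  ∑ (λ j → A zero j * per (minor zero j A))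
    ≡⟨ ∑-remove {i = k} (λ j → A zero j * per (minor zero j A)) ⟩
  A zero k * per (minor zero k A) + ∑ (λ j → A zero (punchIn k j) * per (minor zero (punchIn k j) A))
    ≡⟨ cong (A zero k * per (minor zero k A) +_) rest ⟩
  A zero k * per (minor zero k A) + ∑ (λ i → A (suc i) k * per (minor (suc i) k A)) ∎
  where
  q : Fin (suc m) → Fin (suc m) → ℕ
  q i j = per (minor zero j (minor (suc i) k A))
  step : ∀ j → per (minor zero (punchIn k j) A) ≡ ∑ λ i → A (suc i) k * q i j
  step j with punchIn-swap k j
  ... | p , eq , eqs = trans (per-column (minor zero (punchIn k j) A) p) (∑-cong λ i →
    cong₂ _*_ (cong (A (suc i)) eq) (per-cong λ r c → cong (A (suc (punchIn i r))) (eqs c)))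
  rest : ∑ (λ j → A zero (punchIn k j) * per (minor zero (punchIn k j) A)) ≡
         ∑ (λ i → A (suc i) k * per (minor (suc i) k A))
  rest = begin-equality
    ∑ (λ j → A zero (punchIn k j) * per (minor zero (punchIn k j) A))
      ≡⟨ ∑-cong (λ j → trans (cong (A zero (punchIn k j) *_) (step j)) (*-distribˡ-sum (A zero (punchIn k j)) (λ i → A (suc i) k * q i j))) ⟩
    ∑ (λ j → ∑ λ i → A zero (punchIn k j) * (A (suc i) k * q i j))
      ≡⟨ ∑-comm (λ j i → A zero (punchIn k j) * (A (suc i) k * q i j)) ⟩
    ∑ (λ i → ∑ λ j → A zero (punchIn k j) * (A (suc i) k * q i j))
      ≡⟨ ∑-cong (λ i → ∑-cong λ j → solve 3 (λ a b c → a :* (b :* c) := b :* (a :* c)) refl (A zero (punchIn k j)) (A (suc i) k) (q i j)) ⟩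
    ∑ (λ i → ∑ λ j → A (suc i) k * (A zero (punchIn k j) * q i j))
      ≡⟨ ∑-cong (λ i → trans (sym (*-distribˡ-sum (A (suc i) k) (λ j → A zero (punchIn k j) * q i j)))
                             (cong (A (suc i) k *_) (sym (per-first-row (minor (suc i) k A))))) ⟩
    ∑ (λ i → A (suc i) k * per (minor (suc i) k A)) ∎

per-transpose : ∀ {m} (A : Matrix m) → per (λ i j → A j i) ≡ per A
per-transpose {zero}  A = refl
per-transpose {suc m} A = begin-equality
  per (λ i j → A j i)                                         ≡⟨ per-first-row (λ i j → A j i) ⟩
  ∑ (λ j → A j zero * per (λ r c → minor j zero A c r))
    ≡⟨ ∑-cong (λ j → cong (A j zero *_) (per-transpose (minor j zero A))) ⟩
  ∑ (λ j → A j zero * per (minor j zero A))                   ≡⟨ per-column A zero ⟨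
  per A                                                       ∎

per-row : ∀ {m} (A : Matrix (suc m)) i → per A ≡ ∑ λ k → A i k * per (minor i k A)
per-row A i = begin-equality
  per A                                                       ≡⟨ per-transpose A ⟨
  per (λ i j → A j i)                                         ≡⟨ per-column (λ i j → A j i) i ⟩
  ∑ (λ k → A i k * per (λ r c → minor i k A c r))
    ≡⟨ ∑-cong (λ k → cong (A i k *_) (per-transpose (minor i k A))) ⟩
  ∑ (λ k → A i k * per (minor i k A))                         ∎

-- Brègman's theorem

∏-mono-≤ : ∀ {n} {f g : Fin n → ℕ} → (∀ i → f i ≤ g i) → ∏ f ≤ ∏ g
∏-mono-≤ {zero}  f≤g = ≤-refl
∏-mono-≤ {suc n} f≤g = *-mono-≤ (f≤g zero) (∏-mono-≤ (f≤g ∘ suc))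

∏-const : ∀ n a → ∏ {n} (λ _ → a) ≡ a ^ n
∏-const zero    a = refl
∏-const (suc n) a = cong (a *_) (∏-const n a)

∏-^ : ∀ {n} (f : Fin n → ℕ) k → ∏ f ^ k ≡ ∏ (λ i → f i ^ k)
∏-^ {zero}  f k = ^-zeroˡ k
∏-^ {suc n} f k = trans (^-distrib-* (f zero) (∏ (f ∘ suc)) k) (cong (f zero ^ k *_) (∏-^ (f ∘ suc) k))

^-∑ : ∀ {n} a (e : Fin n → ℕ) → a ^ ∑ e ≡ ∏ (λ i → a ^ e i)
^-∑ {zero}  a e = refl
^-∑ {suc n} a e = trans (^-distribˡ-+-* a (e zero) (∑ (e ∘ suc))) (cong (a ^ e zero *_) (^-∑ a (e ∘ suc)))

-- Both sides run over the pairs (i , j) with i ≠ j. In `bregman` this turns a product over deleted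
-- rows i into one over surviving rows j.
∏-off-diagonal : ∀ {n} (h : Fin (suc n) → Fin (suc n) → ℕ) →
                 ∏ (λ i → ∏ λ j → h i (punchIn i j)) ≡ ∏ (λ j → ∏ λ i → h (punchIn j i) j)
∏-off-diagonal {zero}  h = refl
∏-off-diagonal {suc n} h = begin-equality
  ∏ (λ j → h zero (suc j)) * ∏ (λ i → h (suc i) zero * ∏ λ j → h (suc i) (suc (punchIn i j)))
    ≡⟨ cong (∏ (λ j → h zero (suc j)) *_) (∏-distrib-* (λ i → h (suc i) zero) (λ i → ∏ λ j → h (suc i) (suc (punchIn i j)))) ⟩
  ∏ (λ j → h zero (suc j)) * (∏ (λ i → h (suc i) zero) * ∏ (λ i → ∏ λ j → h (suc i) (suc (punchIn i j))))
    ≡⟨ cong (λ z → ∏ (λ j → h zero (suc j)) * (∏ (λ i → h (suc i) zero) * z)) (∏-off-diagonal (λ i j → h (suc i) (suc j))) ⟩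
  ∏ (λ j → h zero (suc j)) * (∏ (λ i → h (suc i) zero) * ∏ (λ j → ∏ λ i → h (suc (punchIn j i)) (suc j)))
    ≡⟨ solve 3 (λ a b c → a :* (b :* c) := b :* (a :* c)) refl (∏ (λ j → h zero (suc j))) (∏ (λ i → h (suc i) zero)) _ ⟩
  ∏ (λ i → h (suc i) zero) * (∏ (λ j → h zero (suc j)) * ∏ (λ j → ∏ λ i → h (suc (punchIn j i)) (suc j)))
    ≡⟨ cong (∏ (λ i → h (suc i) zero) *_) (∏-distrib-* (λ j → h zero (suc j)) (λ j → ∏ λ i → h (suc (punchIn j i)) (suc j))) ⟨
  ∏ (λ i → h (suc i) zero) * ∏ (λ j → h zero (suc j) * ∏ λ i → h (suc (punchIn j i)) (suc j)) ∎

0^n≡0 : ∀ {n} → 0 < n → 0 ^ n ≡ 0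
0^n≡0 (s≤s _) = refl

^-cancelˡ-≤ : ∀ k .{{_ : NonZero k}} {m n} → m ^ k ≤ n ^ k → m ≤ n
^-cancelˡ-≤ k m^k≤n^k = ≮⇒≥ λ n<m → <⇒≱ (^-monoˡ-< k n<m) m^k≤n^k

∏-if : ∀ {n} (b : Fin n → Bool) x y →
       ∏ (λ k → if b k then y else x) ≡ y ^ ∑ (χ ∘ b) * x ^ ∑ (χ ∘ not ∘ b)
∏-if {zero}  b x y = refl
∏-if {suc n} b x y with b zero | ∏-if (b ∘ suc) x y
... | true  | ih = trans (cong (y *_) ih) (sym (*-assoc y _ _))
... | false | ih = trans (cong (x *_) ih)
  (solve 3 (λ x u v → x :* (u :* v) := u :* (x :* v)) refl x (y ^ ∑ (χ ∘ b ∘ suc)) (x ^ ∑ (χ ∘ not ∘ b ∘ suc)))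

∑χ+∑χnot : ∀ {n} (b : Fin n → Bool) → ∑ (χ ∘ b) + ∑ (χ ∘ not ∘ b) ≡ n
∑χ+∑χnot {zero}  b = refl
∑χ+∑χnot {suc n} b with b zero | ∑χ+∑χnot (b ∘ suc)
... | true  | ih = cong suc ih
... | false | ih = trans (+-suc (∑ (χ ∘ b ∘ suc)) (∑ (χ ∘ not ∘ b ∘ suc))) (cong suc ih)

outdegree : ∀ {m} → Digraph m → Fin m → ℕ
outdegree D i = ∑ (χ ∘ D i)

-- F r plays the role of (r !) ^ (K / r), a K-th power of the Brègman factor of a row with r ones.
record BregmanFactors (L K : ℕ) (F : ℕ → ℕ) : Set where
  field
    0<K : 0 < K
    0<F : ∀ r → 0 < F r
    F^r : ∀ r → r ≤ L → F r ^ r ≡ (r !) ^ K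

module _ {L K F} (factors : BregmanFactors L K F) where
  open BregmanFactors factors

  -- Of P permutations, w k send the row to column k and e k do not. Let the row have r ones.
  -- Deleting a column with a one leaves degree r - 1, with total exponent r * P - P = (r - 1) * P;
  -- the other columns leave degree r, with total exponent (m + 1 - r) * P. Now r^K and F (r - 1)^(r
  -- - 1) = ((r - 1)!)^K multiply to (r!)^K = F r ^ r.
  row-factor : ∀ {m} P (b : Fin (suc m) → Bool) (w e : Fin (suc m) → ℕ) → suc m ≤ L →
    ∑ (χ ∘ b) ≢ 0 → ∑ w ≡ P → (∀ k → e k + w k ≡ P) → (∀ k → b k ≡ false → w k ≡ 0) →
    (∑ (χ ∘ b) ^ K) ^ P * ∏ (λ k → F (∑ (λ c → χ (b (punchIn k c)))) ^ e k) ≡ F (∑ (χ ∘ b)) ^ (suc m * P)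
  row-factor {m} P b w e m<L r≢0 ∑w≡P e+w≡P w≡0 = go (∑ (χ ∘ b)) refl
    where
    go : ∀ r → ∑ (χ ∘ b) ≡ r → (r ^ K) ^ P * ∏ (λ k → F (∑ (λ c → χ (b (punchIn k c)))) ^ e k) ≡ F r ^ (suc m * P)
    go zero    ∑≡0 = contradiction ∑≡0 r≢0
    go r@(suc s) ∑≡r = begin-equality
      (r ^ K) ^ P * ∏ (λ k → F (∑ (λ c → χ (b (punchIn k c)))) ^ e k)
        ≡⟨ cong ((r ^ K) ^ P *_) (trans (∏-cong λ k → cong (_^ e k) (rest k)) Z≡) ⟩
      (r ^ K) ^ P * (y ^ s * x ^ c) ^ P         ≡⟨ ^-distrib-* (r ^ K) (y ^ s * x ^ c) P ⟨
      (r ^ K * (y ^ s * x ^ c)) ^ P             ≡⟨ cong (_^ P) (sym (*-assoc (r ^ K) (y ^ s) (x ^ c))) ⟩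
      (r ^ K * y ^ s * x ^ c) ^ P
        ≡⟨ cong (λ z → (r ^ K * z * x ^ c) ^ P) (F^r s (≤-trans (n≤1+n s) r≤L)) ⟩
      (r ^ K * (s !) ^ K * x ^ c) ^ P           ≡⟨ cong (λ z → (z * x ^ c) ^ P) (^-distrib-* r (s !) K) ⟨
      ((r !) ^ K * x ^ c) ^ P                   ≡⟨ cong (λ z → (z * x ^ c) ^ P) (F^r r r≤L) ⟨
      (x ^ r * x ^ c) ^ P                       ≡⟨ cong (_^ P) (^-distribˡ-+-* x r c) ⟨
      (x ^ (r + c)) ^ P                         ≡⟨ cong (λ z → (x ^ z) ^ P) r+c≡m ⟩
      (x ^ suc m) ^ P                           ≡⟨ ^-*-assoc x (suc m) P ⟩
      x ^ (suc m * P)                           ∎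
      where
      x = F r
      y = F s
      c = ∑ (χ ∘ not ∘ b)
      g : Fin (suc m) → ℕ
      g k = if b k then y else x
      r+c≡m : r + c ≡ suc m
      r+c≡m = trans (cong (_+ c) (sym ∑≡r)) (∑χ+∑χnot b)
      r≤L : r ≤ L
      r≤L = ≤-trans (m≤m+n r c) (≤-trans (≤-reflexive r+c≡m) m<L)
      rest : ∀ k → F (∑ (λ c → χ (b (punchIn k c)))) ≡ g k
      rest k with b k | ∑-remove {i = k} (χ ∘ b)
      ... | true  | eq = cong F (suc-injective (trans (sym eq) ∑≡r))
      ... | false | eq = cong F (trans (sym eq) ∑≡r)
      term : ∀ k → y ^ w k * g k ^ e k ≡ g k ^ P
      term k with b k | w≡0 k
      ... | true  | _    = trans (*-comm (y ^ w k) (y ^ e k)) (trans (sym (^-distribˡ-+-* y (e k) (w k))) (cong (y ^_) (e+w≡P k)))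
      ... | false | wk≡0 = trans (cong (λ z → y ^ z * x ^ e k) (wk≡0 refl)) (trans (*-identityˡ (x ^ e k)) (cong (x ^_)
              (trans (sym (trans (cong (e k +_) (wk≡0 refl)) (+-identityʳ (e k)))) (e+w≡P k))))
      Z≡ : ∏ (λ k → g k ^ e k) ≡ (y ^ s * x ^ c) ^ P
      -- Multiplying by y^P, split as the product of the y^(w k), completes every exponent e k to P
      -- without subtraction.
      Z≡ = *-cancelˡ-≡ _ _ (y ^ P) {{m^n≢0 y P {{>-nonZero (0<F s)}}}} (begin-equality
        y ^ P * ∏ (λ k → g k ^ e k)                    ≡⟨ cong (λ z → y ^ z * ∏ (λ k → g k ^ e k)) ∑w≡P ⟨
        y ^ ∑ w * ∏ (λ k → g k ^ e k)                  ≡⟨ cong (_* ∏ (λ k → g k ^ e k)) (^-∑ y w) ⟩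
        ∏ (λ k → y ^ w k) * ∏ (λ k → g k ^ e k)        ≡⟨ ∏-distrib-* (λ k → y ^ w k) (λ k → g k ^ e k) ⟨
        ∏ (λ k → y ^ w k * g k ^ e k)                  ≡⟨ ∏-cong term ⟩
        ∏ (λ k → g k ^ P)                              ≡⟨ ∏-^ g P ⟨
        ∏ g ^ P                                        ≡⟨ cong (_^ P) (∏-if b x y) ⟩
        (y ^ ∑ (χ ∘ b) * x ^ c) ^ P                    ≡⟨ cong (λ z → (y ^ z * x ^ c) ^ P) ∑≡r ⟩
        (y * y ^ s * x ^ c) ^ P                        ≡⟨ cong (_^ P) (*-assoc y (y ^ s) (x ^ c)) ⟩
        (y * (y ^ s * x ^ c)) ^ P                      ≡⟨ ^-distrib-* y (y ^ s * x ^ c) P ⟩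
        y ^ P * (y ^ s * x ^ c) ^ P                    ∎)

  -- The bounds are multiplied over deleted rows i, regrouped by surviving rows j, and `row-factor`
  -- evaluates each group as F (r j)^(M * P). The outer powers P and M are then cancelled, so a zero
  -- permanent is treated first.
  bregman : ∀ {m} (D : Digraph m) → m ≤ L → per (adjacency D) ^ K ≤ ∏ (F ∘ outdegree D)
  bregman {zero}  D _   = ≤-reflexive (^-zeroˡ K)
  bregman {suc m} D m<L with per (adjacency D) ≟ 0
  ... | yes per≡0 = subst (λ z → z ^ K ≤ ∏ (F ∘ outdegree D)) (sym per≡0) (≤-trans (≤-reflexive (0^n≡0 0<K)) z≤n)
  ... | no per≢0 = ^-cancelˡ-≤ P {{≢-nonZero per≢0}} (^-cancelˡ-≤ M (begin
    ((P ^ K) ^ P) ^ M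
      ≡⟨ ∏-const M ((P ^ K) ^ P) ⟨
    ∏ {M} (λ _ → (P ^ K) ^ P)
      ≤⟨ ∏-mono-≤ row-bound ⟩
    ∏ (λ i → (r i ^ K) ^ P * ∏ (λ j → h i (punchIn i j)))
      ≡⟨ ∏-distrib-* (λ i → (r i ^ K) ^ P) (λ i → ∏ (λ j → h i (punchIn i j))) ⟩
    ∏ (λ i → (r i ^ K) ^ P) * ∏ (λ i → ∏ (λ j → h i (punchIn i j)))
      ≡⟨ cong (∏ (λ i → (r i ^ K) ^ P) *_) (∏-off-diagonal h) ⟩
    ∏ (λ i → (r i ^ K) ^ P) * ∏ (λ j → ∏ (λ i → h (punchIn j i) j))
      ≡⟨ ∏-distrib-* (λ i → (r i ^ K) ^ P) (λ j → ∏ (λ i → h (punchIn j i) j)) ⟨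
    ∏ (λ j → (r j ^ K) ^ P * ∏ (λ i → h (punchIn j i) j))
      ≡⟨ ∏-cong (λ j → trans (cong ((r j ^ K) ^ P *_) (collect j)) (complete j)) ⟩
    ∏ (λ j → F (r j) ^ (M * P))
      ≡⟨ ∏-^ (F ∘ r) (M * P) ⟨
    ∏ (F ∘ r) ^ (M * P)
      ≡⟨ cong (∏ (F ∘ r) ^_) (*-comm M P) ⟩
    ∏ (F ∘ r) ^ (P * M)
      ≡⟨ ^-*-assoc (∏ (F ∘ r)) P M ⟨
    (∏ (F ∘ r) ^ P) ^ M ∎))
    where
    M = suc m
    P = per (adjacency D)
    r = outdegree D
    q w G h : Fin M → Fin M → ℕ
    q i k = per (adjacency (minor i k D))
    w i k = χ (D i k) * q i k
    G j k = F (∑ (λ c → χ (D j (punchIn k c))))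
    h i j = ∏ (λ k → G j k ^ w i k)
    e : Fin M → Fin M → ℕ
    -- Total exponent with which column k is deleted together with a row other than j. Expansion
    -- along column k makes it P minus `w j k`.
    e j k = ∑ (λ i → w (punchIn j i) k)
    row : ∀ i → ∑ (w i) ≡ P
    row i = sym (per-row (adjacency D) i)
    column : ∀ j k → e j k + w j k ≡ P
    column j k = trans (+-comm (e j k) (w j k))
      (trans (sym (∑-remove {i = j} (λ i → w i k))) (sym (per-column (adjacency D) k)))
    entropy : ∀ i → P ^ P ≤ r i ^ P * ∏ (λ k → q i k ^ w i k)
    entropy i = subst (λ T → T ^ T ≤ r i ^ T * ∏ (λ k → q i k ^ w i k)) (row i) (log-sum (D i) (q i))
    row-bound : ∀ i → (P ^ K) ^ P ≤ (r i ^ K) ^ P * ∏ (λ j → h i (punchIn i j))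
    row-bound i = begin
      (P ^ K) ^ P                                              ≡⟨ ^-comm P K P ⟩
      (P ^ P) ^ K                                              ≤⟨ ^-monoˡ-≤ K (entropy i) ⟩
      (r i ^ P * ∏ (λ k → q i k ^ w i k)) ^ K
        ≡⟨ ^-distrib-* (r i ^ P) (∏ (λ k → q i k ^ w i k)) K ⟩
      (r i ^ P) ^ K * ∏ (λ k → q i k ^ w i k) ^ K
        ≡⟨ cong₂ _*_ (^-comm (r i) P K) (∏-^ (λ k → q i k ^ w i k) K) ⟩
      (r i ^ K) ^ P * ∏ (λ k → (q i k ^ w i k) ^ K)
        ≡⟨ cong ((r i ^ K) ^ P *_) (∏-cong λ k → ^-comm (q i k) (w i k) K) ⟩
      (r i ^ K) ^ P * ∏ (λ k → (q i k ^ K) ^ w i k)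
        ≤⟨ *-monoʳ-≤ ((r i ^ K) ^ P) (∏-mono-≤ λ k → ^-monoˡ-≤ (w i k) (bregman (minor i k D) (≤-trans (n≤1+n m) m<L))) ⟩
      (r i ^ K) ^ P * ∏ (λ k → ∏ (λ j → G (punchIn i j) k) ^ w i k)
        ≡⟨ cong ((r i ^ K) ^ P *_) (∏-cong λ k → ∏-^ (λ j → G (punchIn i j) k) (w i k)) ⟩
      (r i ^ K) ^ P * ∏ (λ k → ∏ (λ j → G (punchIn i j) k ^ w i k))
        ≡⟨ cong ((r i ^ K) ^ P *_) (∏-comm (λ k j → G (punchIn i j) k ^ w i k)) ⟩
      (r i ^ K) ^ P * ∏ (λ j → h i (punchIn i j)) ∎
      where
      ^-comm : ∀ a m n → (a ^ m) ^ n ≡ (a ^ n) ^ m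
      ^-comm a m n = trans (^-*-assoc a m n) (trans (cong (a ^_) (*-comm m n)) (sym (^-*-assoc a n m)))
    collect : ∀ j → ∏ (λ i → h (punchIn j i) j) ≡ ∏ (λ k → G j k ^ e j k)
    collect j = trans (∏-comm (λ i k → G j k ^ w (punchIn j i) k))
      (∏-cong λ k → sym (^-∑ (G j k) (λ i → w (punchIn j i) k)))
    r≢0 : ∀ j → r j ≢ 0
    r≢0 j rj≡0 = <⇒≱ (n^n>0 P) (≤-trans (entropy j) (≤-reflexive
      (cong (_* ∏ (λ k → q j k ^ w j k)) (trans (cong (_^ P) rj≡0) (0^n≡0 (n≢0⇒n>0 per≢0))))))
    complete : ∀ j → (r j ^ K) ^ P * ∏ (λ k → G j k ^ e j k) ≡ F (r j) ^ (M * P)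
    complete j = row-factor P (D j) (w j) (e j) m<L (r≢0 j) (row j) (column j)
      (λ k Djk≡false → cong (λ b → χ b * q j k) Djk≡false)

-- Log-concavity of r ↦ (r !) ^ (1 / r)

-- The induction step is 2 * a^a ≤ (a + 1)^a with a = r + 1, Bernoulli's inequality for (1 + 1/a)^a,
-- which is read off from the tangent at a.
2^r*r!≤[1+r]^r : ∀ r → 2 ^ r * r ! ≤ suc r ^ r
2^r*r!≤[1+r]^r zero    = ≤-refl
2^r*r!≤[1+r]^r (suc r) = begin
  2 * 2 ^ r * (a * r !)
    ≡⟨ solve 3 (λ a t f → con 2 :* t :* (a :* f) := con 2 :* (a :* (t :* f))) refl a (2 ^ r) (r !) ⟩
  2 * (a * (2 ^ r * r !))   ≤⟨ *-monoʳ-≤ 2 (*-monoʳ-≤ a (2^r*r!≤[1+r]^r r)) ⟩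
  2 * (a * A)               ≤⟨ +-cancelʳ-≤ (r * (a * A)) _ _ tangent ⟩
  suc a ^ a                 ∎
  where
  a = suc r
  A = a ^ r
  tangent : 2 * (a * A) + r * (a * A) ≤ suc a ^ a + r * (a * A)
  tangent = begin
    2 * (a * A) + r * (a * A)
      ≡⟨ solve 2 (λ r A → con 2 :* ((con 1 :+ r) :* A) :+ r :* ((con 1 :+ r) :* A) := (con 1 :+ r) :* (A :* (con 2 :+ r))) refl r A ⟩
    suc r * (A * suc a)           ≤⟨ tangent-^ r a (suc a) ⟩
    suc a ^ a + r * (a * A)       ∎

-- The arithmetic-geometric mean inequality for s copies of 2(s + 1) and two copies of s.
[1+s]^s≤4s^s : ∀ s → suc s ^ s ≤ 4 * s ^ s
[1+s]^s≤4s^s zero      = s≤s z≤n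
[1+s]^s≤4s^s s@(suc _) = *-cancelˡ-≤ (2 ^ s * (s * (s * N))) {{c≢0}} (begin
  2 ^ s * (s * (s * N)) * suc s ^ s
    ≡⟨ solve 4 (λ t s N S → t :* (s :* (s :* N)) :* S := N :* (s :* (s :* con 1) :* (t :* S))) refl (2 ^ s) s N (suc s ^ s) ⟩
  N * (s ^ 2 * (2 ^ s * suc s ^ s))           ≡⟨ cong (λ z → N * (s ^ 2 * z)) (^-distrib-* 2 (suc s) s) ⟨
  N * (s ^ 2 * (2 * suc s) ^ s)               ≤⟨ weighted-amgm s 2 (2 * suc s) s ⟩
  (2 * s + s * (2 * suc s)) ^ (2 + s)
    ≡⟨ cong (_^ (2 + s)) (solve 1 (λ s → con 2 :* s :+ s :* (con 2 :* (con 1 :+ s)) := (con 2 :+ s) :* (con 2 :* s)) refl s) ⟩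
  ((2 + s) * (2 * s)) ^ (2 + s)               ≡⟨ ^-distrib-* (2 + s) (2 * s) (2 + s) ⟩
  N * (2 * s) ^ (2 + s)                       ≡⟨ cong (λ z → N * (2 * s * (2 * s * z))) (^-distrib-* 2 s s) ⟩
  N * (2 * s * (2 * s * (2 ^ s * s ^ s)))
    ≡⟨ solve 4 (λ N s t S → N :* (con 2 :* s :* (con 2 :* s :* (t :* S))) := t :* (s :* (s :* N)) :* (con 4 :* S)) refl N s (2 ^ s) (s ^ s) ⟩
  2 ^ s * (s * (s * N)) * (4 * s ^ s)         ∎)
  where
  N = (2 + s) ^ (2 + s)
  c≢0 : NonZero (2 ^ s * (s * (s * N)))
  c≢0 = m*n≢0 (2 ^ s) (s * (s * N)) {{m^n≢0 2 s}} {{m*n≢0 s (s * N) {{_}} {{m*n≢0 s N {{_}} {{m^n≢0 (2 + s) (2 + s)}}}}}}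

-- This is log-concavity raised to the power r(r + 1)(r + 2). With a = r + 1 and b = r + 2,
-- cancelling common powers leaves (r!)^2 * (b/a)^(r * a) ≤ a^(2 * r). It follows from (b/a)^a ≤ 4
-- and 2^r * r! ≤ a^r: the factor 4^r is exactly the square of 2^r.
!-log-concave : ∀ r → (r !) ^ (suc r * (2 + r)) * ((2 + r) !) ^ (r * suc r) ≤ (suc r !) ^ (2 * r * (2 + r))
!-log-concave r = begin
  f ^ (a * b) * (b * (a * f)) ^ (r * a)
    ≡⟨ cong (f ^ (a * b) *_) (trans (^-distrib-* b (a * f) (r * a)) (cong (b ^ (r * a) *_) (^-distrib-* a f (r * a)))) ⟩
  f ^ (a * b) * (b ^ (r * a) * (a ^ (r * a) * f ^ (r * a)))
    ≡⟨ solve 4 (λ w x y z → w :* (x :* (y :* z)) := w :* z :* (x :* y)) refl (f ^ (a * b)) (b ^ (r * a)) (a ^ (r * a)) (f ^ (r * a)) ⟩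
  f ^ (a * b) * f ^ (r * a) * (b ^ (r * a) * a ^ (r * a))
    ≡⟨ cong (_* (b ^ (r * a) * a ^ (r * a))) f-powers ⟩
  f ^ (2 * r * b) * f ^ 2 * (b ^ (r * a) * a ^ (r * a))
    ≡⟨ solve 4 (λ w x y z → w :* x :* (y :* z) := w :* (z :* (x :* y))) refl (f ^ (2 * r * b)) (f ^ 2) (b ^ (r * a)) (a ^ (r * a)) ⟩
  f ^ (2 * r * b) * (a ^ (r * a) * (f ^ 2 * b ^ (r * a)))
    ≤⟨ *-monoʳ-≤ (f ^ (2 * r * b)) (*-monoʳ-≤ (a ^ (r * a)) core) ⟩
  f ^ (2 * r * b) * (a ^ (r * a) * (a ^ (2 * r) * a ^ (r * a)))
    ≡⟨ cong (f ^ (2 * r * b) *_) a-powers ⟩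
  f ^ (2 * r * b) * a ^ (2 * r * b)
    ≡⟨ *-comm (f ^ (2 * r * b)) (a ^ (2 * r * b)) ⟩
  a ^ (2 * r * b) * f ^ (2 * r * b)
    ≡⟨ ^-distrib-* a f (2 * r * b) ⟨
  (a * f) ^ (2 * r * b) ∎
  where
  f = r !
  a = suc r
  b = 2 + r
  f-powers : f ^ (a * b) * f ^ (r * a) ≡ f ^ (2 * r * b) * f ^ 2
  f-powers = trans (sym (^-distribˡ-+-* f (a * b) (r * a))) (trans (cong (f ^_)
    (solve 1 (λ r → (con 1 :+ r) :* (con 2 :+ r) :+ r :* (con 1 :+ r) := con 2 :* r :* (con 2 :+ r) :+ con 2) refl r))
    (^-distribˡ-+-* f (2 * r * b) 2))
  a-powers : a ^ (r * a) * (a ^ (2 * r) * a ^ (r * a)) ≡ a ^ (2 * r * b)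
  a-powers = trans (cong (a ^ (r * a) *_) (sym (^-distribˡ-+-* a (2 * r) (r * a)))) (trans
    (sym (^-distribˡ-+-* a (r * a) (2 * r + r * a))) (cong (a ^_)
    (solve 1 (λ r → r :* (con 1 :+ r) :+ (con 2 :* r :+ r :* (con 1 :+ r)) := con 2 :* r :* (con 2 :+ r)) refl r)))
  core : f ^ 2 * b ^ (r * a) ≤ a ^ (2 * r) * a ^ (r * a)
  core = begin
    f ^ 2 * b ^ (r * a)                    ≡⟨ cong (λ z → f ^ 2 * b ^ z) (*-comm r a) ⟩
    f ^ 2 * b ^ (a * r)                    ≡⟨ cong (f ^ 2 *_) (^-*-assoc b a r) ⟨
    f ^ 2 * (b ^ a) ^ r                    ≤⟨ *-monoʳ-≤ (f ^ 2) (^-monoˡ-≤ r ([1+s]^s≤4s^s a)) ⟩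
    f ^ 2 * (4 * a ^ a) ^ r                ≡⟨ cong (f ^ 2 *_) (^-distrib-* 4 (a ^ a) r) ⟩
    f ^ 2 * (4 ^ r * (a ^ a) ^ r)
      ≡⟨ cong₂ (λ z w → f ^ 2 * (z * w)) (^-distrib-* 2 2 r) (trans (^-*-assoc a a r) (cong (a ^_) (*-comm a r))) ⟩
    f ^ 2 * (2 ^ r * 2 ^ r * a ^ (r * a))
      ≡⟨ solve 3 (λ f t A → f :* (f :* con 1) :* (t :* t :* A) := t :* f :* (t :* f) :* A) refl f (2 ^ r) (a ^ (r * a)) ⟩
    2 ^ r * f * (2 ^ r * f) * a ^ (r * a)
      ≤⟨ *-monoˡ-≤ (a ^ (r * a)) (*-mono-≤ (2^r*r!≤[1+r]^r r) (2^r*r!≤[1+r]^r r)) ⟩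
    a ^ r * a ^ r * a ^ (r * a)
      ≡⟨ cong (_* a ^ (r * a)) (trans (sym (^-distribˡ-+-* a r r)) (cong (λ z → a ^ (r + z)) (sym (+-identityʳ r)))) ⟩
    a ^ (2 * r) * a ^ (r * a)              ∎

-- Balancing the degrees in the product of factors

module Concavity {L K F} (factors : BregmanFactors L K F) where
  open BregmanFactors factors

  F^[r*m] : ∀ {r} m → r ≤ L → F r ^ (r * m) ≡ ((r !) ^ m) ^ K
  F^[r*m] {r} m r≤L = begin-equality
    F r ^ (r * m)         ≡⟨ ^-*-assoc (F r) r m ⟨
    (F r ^ r) ^ m         ≡⟨ cong (_^ m) (F^r r r≤L) ⟩
    ((r !) ^ K) ^ m       ≡⟨ ^-*-assoc (r !) K m ⟩
    (r !) ^ (K * m)       ≡⟨ cong ((r !) ^_) (*-comm K m) ⟩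
    (r !) ^ (m * K)       ≡⟨ ^-*-assoc (r !) m K ⟨
    ((r !) ^ m) ^ K       ∎

  -- The equation `F^r` leaves `F 0` free, since its zeroth power is 1 in any case; this is the
  -- source of the condition 0 < r.
  log-concave : ∀ r → 0 < r → 2 + r ≤ L → F r * F (2 + r) ≤ F (1 + r) * F (1 + r)
  log-concave r@(suc _) _ b≤L = ^-cancelˡ-≤ (r * (a * b)) (begin
    (F r * F b) ^ (r * (a * b))                                ≡⟨ ^-distrib-* (F r) (F b) (r * (a * b)) ⟩
    F r ^ (r * (a * b)) * F b ^ (r * (a * b))
      ≡⟨ cong (λ z → F r ^ (r * (a * b)) * F b ^ z) (solve 3 (λ r a b → r :* (a :* b) := b :* (r :* a)) refl r a b) ⟩
    F r ^ (r * (a * b)) * F b ^ (b * (r * a))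
      ≡⟨ cong₂ _*_ (F^[r*m] (a * b) (≤-trans (n≤1+n r) a≤L)) (F^[r*m] (r * a) b≤L) ⟩
    ((r !) ^ (a * b)) ^ K * ((b !) ^ (r * a)) ^ K
      ≡⟨ ^-distrib-* ((r !) ^ (a * b)) ((b !) ^ (r * a)) K ⟨
    ((r !) ^ (a * b) * (b !) ^ (r * a)) ^ K                    ≤⟨ ^-monoˡ-≤ K (!-log-concave r) ⟩
    ((a !) ^ (2 * r * b)) ^ K                                  ≡⟨ F^[r*m] (2 * r * b) a≤L ⟨
    F a ^ (a * (2 * r * b))
      ≡⟨ cong (F a ^_) (solve 3 (λ r a b → a :* (con 2 :* r :* b) := r :* (a :* b) :+ r :* (a :* b)) refl r a b) ⟩
    F a ^ (r * (a * b) + r * (a * b))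
      ≡⟨ ^-distribˡ-+-* (F a) (r * (a * b)) (r * (a * b)) ⟩
    F a ^ (r * (a * b)) * F a ^ (r * (a * b))                  ≡⟨ ^-distrib-* (F a) (F a) (r * (a * b)) ⟨
    (F a * F a) ^ (r * (a * b))                                ∎)
    where
    a = 1 + r
    b = 2 + r
    a≤L = ≤-trans (n≤1+n a) b≤L

  ratio-antitone : ∀ d a → 0 < a → 1 + (d + a) ≤ L → F (1 + (d + a)) * F a ≤ F (d + a) * F (1 + a)
  ratio-antitone zero    a _   _   = ≤-reflexive (*-comm (F (1 + a)) (F a))
  ratio-antitone (suc d) a 0<a b<L = *-cancelʳ-≤ _ _ (F b) {{>-nonZero (0<F b)}} (begin
    F (2 + b) * F a * F b          ≡⟨ solve 3 (λ x y z → x :* y :* z := z :* x :* y) refl (F (2 + b)) (F a) (F b) ⟩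
    F b * F (2 + b) * F a          ≤⟨ *-monoˡ-≤ (F a) (log-concave b (≤-trans 0<a (m≤n+m a d)) b<L) ⟩
    F (1 + b) * F (1 + b) * F a    ≡⟨ *-assoc (F (1 + b)) (F (1 + b)) (F a) ⟩
    F (1 + b) * (F (1 + b) * F a)  ≤⟨ *-monoʳ-≤ (F (1 + b)) (ratio-antitone d a 0<a (≤-trans (n≤1+n _) b<L)) ⟩
    F (1 + b) * (F b * F (1 + a))
      ≡⟨ solve 3 (λ x y z → x :* (y :* z) := x :* z :* y) refl (F (1 + b)) (F b) (F (1 + a)) ⟩
    F (1 + b) * F (1 + a) * F b    ∎)
    where b = d + a

  module _ {k} (0<k : 0 < k) (k<L : k < L) where
    private
      x = F k
      y = F (1 + k)

    -- Cleared of denominators, the claim is F r ≤ x * (y / x)^(r - k): a log-concave sequence lies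
    -- below the exponential through its values at k and k + 1. Moving r away from k by one step
    -- costs one application of `ratio-antitone`.
    tangent-below : ∀ d r → 0 < r → d + r ≡ k → F r * (x ^ r * y ^ k) ≤ x ^ suc k * y ^ r
    tangent-below zero    r _   refl = ≤-reflexive (sym (*-assoc (F r) (F r ^ r) (F (1 + r) ^ r)))
    tangent-below (suc d) r 0<r refl = *-cancelʳ-≤ _ _ y {{>-nonZero (0<F (1 + k))}} (begin
      F r * (x ^ r * y ^ k) * y
        ≡⟨ solve 4 (λ f X Y y → f :* (X :* Y) :* y := y :* f :* (X :* Y)) refl (F r) (x ^ r) (y ^ k) y ⟩
      y * F r * (x ^ r * y ^ k)            ≤⟨ *-monoˡ-≤ (x ^ r * y ^ k) (ratio-antitone (suc d) r 0<r k<L) ⟩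
      x * F (1 + r) * (x ^ r * y ^ k)
        ≡⟨ solve 4 (λ x f X Y → x :* f :* (X :* Y) := f :* (x :* X :* Y)) refl x (F (1 + r)) (x ^ r) (y ^ k) ⟩
      F (1 + r) * (x ^ suc r * y ^ k)      ≤⟨ tangent-below d (suc r) (s≤s z≤n) (+-suc d r) ⟩
      x ^ suc k * (y * y ^ r)
        ≡⟨ solve 3 (λ X y Y → X :* (y :* Y) := X :* Y :* y) refl (x ^ suc k) y (y ^ r) ⟩
      x ^ suc k * y ^ r * y                ∎)

    tangent-above : ∀ d → d + k ≤ L → F (d + k) * (x ^ (d + k) * y ^ k) ≤ x ^ suc k * y ^ (d + k)
    tangent-above zero    _   = ≤-reflexive (sym (*-assoc x (x ^ k) (y ^ k)))
    tangent-above (suc d) r<L = begin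
      F (1 + r) * (x * x ^ r * y ^ k)
        ≡⟨ solve 4 (λ x f X Y → f :* (x :* X :* Y) := f :* x :* (X :* Y)) refl x (F (1 + r)) (x ^ r) (y ^ k) ⟩
      F (1 + r) * x * (x ^ r * y ^ k)      ≤⟨ *-monoˡ-≤ (x ^ r * y ^ k) (ratio-antitone d k 0<k r<L) ⟩
      F r * y * (x ^ r * y ^ k)
        ≡⟨ solve 4 (λ f y X Y → f :* y :* (X :* Y) := y :* (f :* (X :* Y))) refl (F r) y (x ^ r) (y ^ k) ⟩
      y * (F r * (x ^ r * y ^ k))          ≤⟨ *-monoʳ-≤ y (tangent-above d (≤-trans (n≤1+n r) r<L)) ⟩
      y * (x ^ suc k * y ^ r)
        ≡⟨ solve 3 (λ X y Y → y :* (X :* Y) := X :* (y :* Y)) refl (x ^ suc k) y (y ^ r) ⟩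
      x ^ suc k * (y * y ^ r)              ∎
      where r = d + k

    tangent : ∀ r → 0 < r → r ≤ L → F r * (x ^ r * y ^ k) ≤ x ^ suc k * y ^ r
    tangent r 0<r r≤L with ≤-total r k
    ... | inj₁ r≤k = tangent-below (k ∸ r) r 0<r (m∸n+n≡m r≤k)
    ... | inj₂ k≤r = subst (λ r → F r * (x ^ r * y ^ k) ≤ x ^ suc k * y ^ r) (m∸n+n≡m k≤r)
                       (tangent-above (r ∸ k) (≤-trans (≤-reflexive (m∸n+n≡m k≤r)) r≤L))

    -- The bound x * (y / x)^(r - k) is exponential in r, so its product over all rows depends only
    -- on N and the sum of the degrees. That product is x^N * (y / x)^α, and no exchange of degrees
    -- between rows is called for.
    ∏F≤balanced : ∀ {N} (r : Fin N → ℕ) α β → β + α ≡ N → ∑ r ≡ N * k + α →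
                  (∀ i → 0 < r i) → (∀ i → r i ≤ L) → ∏ (F ∘ r) ≤ x ^ β * y ^ α
    ∏F≤balanced {N} r α β β+α≡N ∑r≡ 0<r r≤L = *-cancelʳ-≤ _ _ C {{C≢0}} (begin
      ∏ (F ∘ r) * C
        ≡⟨ cong₂ (λ s t → ∏ (F ∘ r) * (s * t)) x-part y-part ⟩
      ∏ (F ∘ r) * (∏ (λ i → x ^ r i) * ∏ {N} (λ _ → y ^ k))
        ≡⟨ cong (∏ (F ∘ r) *_) (∏-distrib-* (λ i → x ^ r i) (λ _ → y ^ k)) ⟨
      ∏ (F ∘ r) * ∏ (λ i → x ^ r i * y ^ k)
        ≡⟨ ∏-distrib-* (F ∘ r) (λ i → x ^ r i * y ^ k) ⟨
      ∏ (λ i → F (r i) * (x ^ r i * y ^ k))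
        ≤⟨ ∏-mono-≤ (λ i → tangent (r i) (0<r i) (r≤L i)) ⟩
      ∏ (λ i → x ^ suc k * y ^ r i)
        ≡⟨ ∏-distrib-* (λ _ → x ^ suc k) (λ i → y ^ r i) ⟩
      ∏ {N} (λ _ → x ^ suc k) * ∏ (λ i → y ^ r i)
        ≡⟨ cong₂ _*_ (trans (∏-const N (x ^ suc k)) (^-*-assoc x (suc k) N)) (trans (sym (^-∑ y r)) (cong (y ^_) ∑r≡)) ⟩
      x ^ (suc k * N) * y ^ (N * k + α)
        ≡⟨ cong₂ _*_ (trans (cong (x ^_) exponents) (^-distribˡ-+-* x β (N * k + α))) (^-distribˡ-+-* y (N * k) α) ⟩
      x ^ β * x ^ (N * k + α) * (y ^ (N * k) * y ^ α)
        ≡⟨ solve 4 (λ a b c d → a :* b :* (c :* d) := a :* d :* (b :* c)) refl (x ^ β) (x ^ (N * k + α)) (y ^ (N * k)) (y ^ α) ⟩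
      x ^ β * y ^ α * C ∎)
      where
      C = x ^ (N * k + α) * y ^ (N * k)
      C≢0 : NonZero C
      C≢0 = m*n≢0 (x ^ (N * k + α)) (y ^ (N * k)) {{m^n≢0 x (N * k + α) {{>-nonZero (0<F k)}}}}
              {{m^n≢0 y (N * k) {{>-nonZero (0<F (1 + k))}}}}
      x-part : x ^ (N * k + α) ≡ ∏ (λ i → x ^ r i)
      x-part = trans (cong (x ^_) (sym ∑r≡)) (^-∑ x r)
      y-part : y ^ (N * k) ≡ ∏ {N} (λ _ → y ^ k)
      y-part = sym (trans (∏-const N (y ^ k)) (trans (^-*-assoc y k N) (cong (y ^_) (*-comm k N))))
      exponents : suc k * N ≡ β + (N * k + α)
      exponents = trans (cong (_+ k * N) (sym β+α≡N)) (trans (cong (β + α +_) (*-comm k N))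
        (solve 3 (λ b a c → b :+ a :+ c := b :+ (c :+ a)) refl β α (N * k)))

-- Integral powers of (r!)^(1/r)

r∣n! : ∀ {r n} .{{_ : NonZero r}} → r ≤ n → r ∣ n !
r∣n! {suc s} r≤n = ∣-trans (m∣m*n (s !)) (m≤n⇒m!∣n! r≤n)

-- For 1 ≤ r ≤ L the division is exact, so this is (r!)^(1/r) raised to the power L!. The value at 0
-- is a default that keeps all factors positive.
factor : ℕ → ℕ → ℕ
factor L zero      = 1
factor L r@(suc _) = (r !) ^ (L ! / r)

factors : ∀ L → BregmanFactors L (L !) (factor L)
factors L = record { 0<K = 1≤n! L ; 0<F = pos ; F^r = root-of }
  where
  pos : ∀ r → 0 < factor L r
  pos zero      = s≤s z≤n
  pos r@(suc _) = m^n>0 (r !) {{r !≢0}} (L ! / r)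
  root-of : ∀ r → r ≤ L → factor L r ^ r ≡ (r !) ^ (L !)
  root-of zero      _   = sym (^-zeroˡ (L !))
  root-of r@(suc _) r≤L = trans (^-*-assoc (r !) (L ! / r) r) (cong ((r !) ^_) (m/n*n≡m (r∣n! r≤L)))

-- The upper bound

∑χ≡0⇒∑χ*≡0 : ∀ {n} (b : Fin n → Bool) (q : Fin n → ℕ) → ∑ (χ ∘ b) ≡ 0 → ∑ (λ k → χ (b k) * q k) ≡ 0
∑χ≡0⇒∑χ*≡0 {zero}  b q _   = refl
∑χ≡0⇒∑χ*≡0 {suc n} b q eq with b zero | eq
... | false | ∑≡0 = ∑χ≡0⇒∑χ*≡0 (b ∘ suc) (q ∘ suc) ∑≡0

per≢0⇒0<outdegree : ∀ {m} (D : Digraph m) → per (adjacency D) ≢ 0 → ∀ i → 0 < outdegree D i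
per≢0⇒0<outdegree {suc m} D per≢0 i = n≢0⇒n>0 λ r≡0 →
  per≢0 (trans (per-row (adjacency D) i) (∑χ≡0⇒∑χ*≡0 (D i) (λ k → per (adjacency (minor i k D))) r≡0))

outdegree≤m : ∀ {m} (D : Digraph m) i → outdegree D i ≤ m
outdegree≤m D i = subst (outdegree D i ≤_) (∑χ+∑χnot (D i)) (m≤m+n _ _)

⌈/⌉≡1+⌊/⌋ : ∀ M N .{{_ : NonZero N}} → M % N ≢ 0 → ⌈ M / N ⌉ ≡ suc ⌊ M / N ⌋
⌈/⌉≡1+⌊/⌋ M N@(suc n) M%N≢0 = lemma (M % N) refl
  where
  k = M / N
  lemma : ∀ α → M % N ≡ α → (M + n) / N ≡ suc k
  lemma zero    M%N≡0 = contradiction M%N≡0 M%N≢0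
  lemma (suc α) M%N≡α = begin-equality
    (M + n) / N                      ≡⟨ cong (λ z → (z + n) / N) (m≡m%n+[m/n]*n M N) ⟩
    (M % N + k * N + n) / N          ≡⟨ cong (λ z → (z + k * N + n) / N) M%N≡α ⟩
    (suc α + k * N + n) / N
      ≡⟨ cong (_/ N) (solve 3 (λ a c n → con 1 :+ a :+ c :+ n := a :+ (con 1 :+ n :+ c)) refl α (k * N) n) ⟩
    (α + suc k * N) / N              ≡⟨ +-distrib-/-∣ʳ α (n∣m*n (suc k)) ⟩
    α / N + suc k * N / N
      ≡⟨ cong₂ _+_ (m<n⇒m/n≡0 (≤-trans (n≤1+n (suc α)) (subst (_< N) M%N≡α (m%n<n M N)))) (m*n/n≡m (suc k) N) ⟩
    suc k                            ∎

factor≡ : ∀ L r .{{_ : NonZero r}} → factor L r ≡ (r !) ^ (L ! / r)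
factor≡ L (suc _) = refl

per≤ω : ∀ {m N M} (D : Digraph m) → m ≡ N → ∑ (outdegree D) ≡ M → (0<N : 0 < N) (N≤M : N ≤ M) →
        fromℕ (per (adjacency D)) ≤ℝ ω[2× N , M ] 0<N N≤M
per≤ω {N} {_} {M} D refl ∑≡M 0<N N≤M = ≤-*ℝ {p = per (adjacency D)} λ (0<s , X<s^k) (0<t , Y<t^c) →
  ≤-product-above k c {K} {K / k} {K / c} {(k !) ^ (N ∸ α)} {(c !) ^ α} {per (adjacency D)} (1≤n! L)
    (m/n*n≡m (r∣n! k≤L)) (m/n*n≡m (r∣n! c≤L)) (≤-trans bound (≤-reflexive powers))
    (ℚ.<⇒≤ 0<s) (ℚ.<⇒≤ 0<t) (ℚ.<⇒≤ X<s^k) (ℚ.<⇒≤ Y<t^c)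
  where
  instance
    N≢0 : NonZero N
    N≢0 = >-nonZero 0<N
  -- Large enough for the order N of the matrix and for the degrees `suc k` and c.
  L = M + N
  K = L !
  k = M / N
  c = (M + (N ∸ 1)) / N
  α = M ∸ N * k
  0<k : 0 < k
  0<k = m≥n⇒m/n>0 N≤M
  instance
    k≢0 : NonZero k
    k≢0 = >-nonZero 0<k
    c≢0 : NonZero c
    c≢0 = >-nonZero (m≥n⇒m/n>0 (≤-trans N≤M (m≤m+n M (N ∸ 1))))
  k≤M : k ≤ M
  k≤M = m/n≤m M N
  k<L : k < L
  k<L = ≤-trans (≤-reflexive (+-comm 1 k)) (+-mono-≤ k≤M 0<N)
  k≤L : k ≤ L
  k≤L = <⇒≤ k<L
  c≤L : c ≤ L
  c≤L = ≤-trans (m/n≤m (M + (N ∸ 1)) N) (+-monoʳ-≤ M (m∸n≤m N 1))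
  α≡M%N : α ≡ M % N
  α≡M%N = trans (cong (M ∸_) (*-comm N k)) (sym (m%n≡m∸m/n*n M N))
  α≤N : α ≤ N
  α≤N = ≤-trans (≤-reflexive α≡M%N) (<⇒≤ (m%n<n M N))
  Nk≤M : N * k ≤ M
  Nk≤M = ≤-trans (≤-reflexive (*-comm N k)) (m/n*n≤m M N)
  F = factor L
  open Concavity (factors L)
  bound : per (adjacency D) ^ K ≤ F k ^ (N ∸ α) * F (suc k) ^ α
  bound with per (adjacency D) ≟ 0
  ... | yes per≡0 = subst (λ z → z ^ K ≤ F k ^ (N ∸ α) * F (suc k) ^ α) (sym per≡0)
                      (≤-trans (≤-reflexive (0^n≡0 (1≤n! L))) z≤n)
  ... | no  per≢0 = ≤-trans (bregman (factors L) D (m≤n+m N M))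
    (∏F≤balanced 0<k k<L (outdegree D) α (N ∸ α) (m∸n+n≡m α≤N) (trans ∑≡M (sym (m+[n∸m]≡n Nk≤M)))
      (per≢0⇒0<outdegree D per≢0) (λ i → ≤-trans (outdegree≤m D i) (m≤n+m N M)))
  F-power : ∀ r .{{_ : NonZero r}} e → F r ^ e ≡ ((r !) ^ e) ^ (K / r)
  F-power r e = trans (cong (_^ e) (factor≡ L r)) (trans (^-*-assoc (r !) (K / r) e)
    (trans (cong ((r !) ^_) (*-comm (K / r) e)) (sym (^-*-assoc (r !) e (K / r)))))
  -- If N divides M, the ceiling is k rather than `suc k`, but then α = 0 and both powers are 1.
  ceiling : F (suc k) ^ α ≡ F c ^ α
  ceiling with α ≟ 0
  ... | yes α≡0 = trans (cong (F (suc k) ^_) α≡0) (cong (F c ^_) (sym α≡0))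
  ... | no  α≢0 = cong (λ z → F z ^ α) (sym (⌈/⌉≡1+⌊/⌋ M N (α≢0 ∘ trans α≡M%N)))
  powers : F k ^ (N ∸ α) * F (suc k) ^ α ≡ ((k !) ^ (N ∸ α)) ^ (K / k) * ((c !) ^ α) ^ (K / c)
  powers = cong₂ _*_ (F-power k (N ∸ α)) (trans ceiling (F-power c α))

-- The number of arcs of an orientation

∑-↑ : ∀ m {n} (f : Fin (m + n) → ℕ) → ∑ f ≡ ∑ (λ i → f (i ↑ˡ n)) + ∑ (λ j → f (m ↑ʳ j))
∑-↑ zero    f = refl
∑-↑ (suc m) f = trans (cong (f zero +_) (∑-↑ m (f ∘ suc))) (sym (+-assoc (f zero) _ _))

∑-zero : ∀ {n} (f : Fin n → ℕ) → (∀ i → f i ≡ 0) → ∑ f ≡ 0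
∑-zero {zero}  f f≡0 = refl
∑-zero {suc n} f f≡0 = cong₂ _+_ (f≡0 zero) (∑-zero (f ∘ suc) (f≡0 ∘ suc))

∑-const : ∀ n a → ∑ {n} (λ _ → a) ≡ n * a
∑-const zero    a = refl
∑-const (suc n) a = cong (a +_) (∑-const n a)

left : ∀ {n} → Fin n ⊎ Fin n → Bool
left = [ const true , const false ]′

module _ {n} (D : 𝒟 n) where
  open 𝒟 D
  open IsOrientation isOrientation
  open Graph (K n , n)

  no-arc : ∀ {u v} → edge u v ≡ false → χ (digraph u v) ≡ 0
  no-arc {u} {v} eq with digraph u v | arcs-along-edges u v
  ... | false | _  = refl
  ... | true  | to = ⊥-elim (subst T eq (to _))

  one-arc : ∀ {u v} → edge u v ≡ true → χ (digraph u v) + χ (digraph v u) ≡ 1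
  one-arc {u} {v} eq with digraph u v | digraph v u | one-direction u v (subst T (sym eq) _)
  ... | true  | _ | refl = refl
  ... | false | _ | refl = refl

  -- The arcs leaving the right side are summed in the opposite order, so that the two possible arcs
  -- between i and j meet and contribute 1 for each of the n * n pairs.
  number-of-arcs : ∑ (outdegree digraph) ≡ n ^ 2
  number-of-arcs = begin-equality
    ∑ (outdegree digraph)
      ≡⟨ ∑-↑ n (outdegree digraph) ⟩
    ∑ (λ i → outdegree digraph (i ↑ˡ n)) + ∑ (λ j → outdegree digraph (n ↑ʳ j))
      ≡⟨ cong₂ _+_ (∑-cong from-left) (∑-cong from-right) ⟩
    ∑ (λ i → ∑ (λ j → LR i j)) + ∑ (λ j → ∑ (λ i → RL j i))
      ≡⟨ cong (∑ (λ i → ∑ (λ j → LR i j)) +_) (∑-comm RL) ⟩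
    ∑ (λ i → ∑ (λ j → LR i j)) + ∑ (λ i → ∑ (λ j → RL j i))
      ≡⟨ ∑-distrib-+ (λ i → ∑ (LR i)) (λ i → ∑ (λ j → RL j i)) ⟨
    ∑ (λ i → ∑ (λ j → LR i j) + ∑ (λ j → RL j i))
      ≡⟨ ∑-cong (λ i → trans (sym (∑-distrib-+ (LR i) (λ j → RL j i))) (trans (∑-cong (λ j → one-arc {i ↑ˡ n} {n ↑ʳ j} (across i j))) (∑-const n 1))) ⟩
    ∑ {n} (λ i → n * 1)
      ≡⟨ ∑-const n (n * 1) ⟩
    n ^ 2 ∎
    where
    LR RL : Fin n → Fin n → ℕ
    LR i j = χ (digraph (i ↑ˡ n) (n ↑ʳ j))
    RL j i = χ (digraph (n ↑ʳ j) (i ↑ˡ n))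
    across : ∀ i j → edge (i ↑ˡ n) (n ↑ʳ j) ≡ true
    across i j = cong₂ (λ a b → left a xor left b) (Fin.splitAt-↑ˡ n i n) (Fin.splitAt-↑ʳ n n j)
    left-left : ∀ i j → edge (i ↑ˡ n) (j ↑ˡ n) ≡ false
    left-left i j = cong₂ (λ a b → left a xor left b) (Fin.splitAt-↑ˡ n i n) (Fin.splitAt-↑ˡ n j n)
    right-right : ∀ i j → edge (n ↑ʳ i) (n ↑ʳ j) ≡ false
    right-right i j = cong₂ (λ a b → left a xor left b) (Fin.splitAt-↑ʳ n n i) (Fin.splitAt-↑ʳ n n j)
    from-left : ∀ i → outdegree digraph (i ↑ˡ n) ≡ ∑ (λ j → LR i j)
    from-left i = trans (∑-↑ n (χ ∘ digraph (i ↑ˡ n))) (cong (_+ ∑ (LR i))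
      (∑-zero (λ j → χ (digraph (i ↑ˡ n) (j ↑ˡ n))) (λ j → no-arc (left-left i j))))
    from-right : ∀ j → outdegree digraph (n ↑ʳ j) ≡ ∑ (λ i → RL j i)
    from-right j = trans (∑-↑ n (χ ∘ digraph (n ↑ʳ j))) (trans (cong (∑ (RL j) +_)
      (∑-zero (λ i → χ (digraph (n ↑ʳ j) (n ↑ʳ i))) (λ i → no-arc (right-right j i)))) (+-identityʳ (∑ (RL j))))

-- The extremal orientation

count : ∀ {m q} → (Fin m → Fin q) → Fin q → ℕ
count f y = ∑ λ i → χ (does (y Fin.≟ f i))

∏-!-increment : ∀ {q} (x : Fin q) (n : Fin q → ℕ) →
                ∏ (λ y → (χ (does (y Fin.≟ x)) + n y) !) ≡ suc (n x) * ∏ (λ y → n y !)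
∏-!-increment {suc q} x n = begin-equality
  ∏ f                                            ≡⟨ ∏-remove {i = x} f ⟩
  f x * ∏ (λ y → f (punchIn x y))                ≡⟨ cong₂ _*_ at-x (∏-cong off-x) ⟩
  suc (n x) * n x ! * ∏ (λ y → n (punchIn x y) !)   ≡⟨ *-assoc (suc (n x)) (n x !) _ ⟩
  suc (n x) * (n x ! * ∏ (λ y → n (punchIn x y) !)) ≡⟨ cong (suc (n x) *_) (∏-remove {i = x} (λ y → n y !)) ⟨
  suc (n x) * ∏ (λ y → n y !)                    ∎
  where
  f : Fin (suc q) → ℕ
  f y = (χ (does (y Fin.≟ x)) + n y) !
  at-x : f x ≡ suc (n x) * n x !
  at-x = cong (λ b → (χ b + n x) !) (dec-true (x Fin.≟ x) refl)
  off-x : ∀ y → f (punchIn x y) ≡ n (punchIn x y) !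
  off-x y = cong (λ b → (χ b + n (punchIn x y)) !) (dec-false (punchIn x y Fin.≟ x) (Fin.punchInᵢ≢i x y))

-- Up to reordering, the matrix is a direct sum of square all-ones blocks, and a block of order s
-- has permanent s!. Labels instead of sorted blocks make the induction close: the first row has a
-- one for each column of its class, and every minor at such a one is again of this kind, with that
-- class reduced by one.
per-classes : ∀ {m q} (r c : Fin m → Fin q) → (∀ y → count r y ≡ count c y) →
              per (adjacency λ i j → does (r i Fin.≟ c j)) ≡ ∏ (λ y → count r y !)
per-classes {zero}  {q} r c _  = sym (trans (∏-const q 1) (^-zeroˡ q))
per-classes {suc m} {q} r c eq = begin-equality
  per (adjacency λ i j → does (r i Fin.≟ c j))
    ≡⟨ per-first-row (adjacency λ i j → does (r i Fin.≟ c j)) ⟩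
  ∑ (λ j → χ (does (x Fin.≟ c j)) * per (adjacency λ i k → does (r (suc i) Fin.≟ c (punchIn j k))))
    ≡⟨ ∑-cong term ⟩
  ∑ (λ j → χ (does (x Fin.≟ c j)) * Q)
    ≡⟨ *-distribʳ-sum Q (λ j → χ (does (x Fin.≟ c j))) ⟨
  count c x * Q
    ≡⟨ cong (_* Q) (trans (sym (eq x)) (cong (λ b → χ b + count r′ x) (dec-true (x Fin.≟ x) refl))) ⟩
  suc (count r′ x) * Q
    ≡⟨ ∏-!-increment x (count r′) ⟨
  ∏ (λ y → count r y !) ∎
  where
  x = r zero
  r′ : Fin m → Fin q
  r′ i = r (suc i)
  Q = ∏ (λ y → count r′ y !)
  counts : ∀ j → x ≡ c j → ∀ y → count r′ y ≡ count (λ k → c (punchIn j k)) y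
  counts j x≡cj y = +-cancelˡ-≡ (χ (does (y Fin.≟ x))) _ _ (trans (eq y) (trans
    (∑-remove {i = j} (λ k → χ (does (y Fin.≟ c k))))
    (cong (λ z → χ (does (y Fin.≟ z)) + count (λ k → c (punchIn j k)) y) (sym x≡cj))))
  term : ∀ j → χ (does (x Fin.≟ c j)) * per (adjacency λ i k → does (r (suc i) Fin.≟ c (punchIn j k))) ≡ χ (does (x Fin.≟ c j)) * Q
  term j with x Fin.≟ c j
  ... | no  _    = refl
  ... | yes x≡cj = cong (1 *_) (per-classes r′ (λ k → c (punchIn j k)) (counts j x≡cj))

-- The halves alternate by parity instead of being cut at n / 2, so `cyclic` is an orientation for
-- every n and evenness matters only when the halves are counted.
half : ∀ {n} → Fin n → Bool
half zero    = true
half (suc i) = not (half i)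

∑-half : ∀ h (f : Bool → ℕ) → ∑ {h * 2} (f ∘ half) ≡ h * (f true + f false)
∑-half zero    f = refl
∑-half (suc h) f = begin-equality
  f true + (f false + ∑ {h * 2} (λ i → f (not (not (half i)))))
    ≡⟨ +-assoc (f true) (f false) _ ⟨
  f true + f false + ∑ {h * 2} (λ i → f (not (not (half i))))
    ≡⟨ cong (f true + f false +_) (∑-cong {h * 2} (λ i → cong f (not-involutive (half i)))) ⟩
  f true + f false + ∑ {h * 2} (λ i → f (half i))
    ≡⟨ cong (f true + f false +_) (∑-half h f) ⟩
  f true + f false + h * (f true + f false) ∎

-- The two halves of each side in the cyclic order left, right, left, right.
quarter : ∀ {n} → Fin n ⊎ Fin n → Fin 4
quarter = [ (λ i → if half i then 0F else 2F) , (λ j → if half j then 1F else 3F) ]′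

next : Fin 4 → Fin 4
next 0F = 1F
next 1F = 2F
next 2F = 3F
next 3F = 0F

next-crosses : ∀ {n} (x y : Fin n ⊎ Fin n) → T (does (next (quarter x) Fin.≟ quarter y)) → T (left x xor left y)
next-crosses (inj₁ i) (inj₂ j) _ = _
next-crosses (inj₂ i) (inj₁ j) _ = _
next-crosses (inj₁ i) (inj₁ j) with half i | half j
... | true  | true  = λ ()
... | true  | false = λ ()
... | false | true  = λ ()
... | false | false = λ ()
next-crosses (inj₂ i) (inj₂ j) with half i | half j
... | true  | true  = λ ()
... | true  | false = λ ()
... | false | true  = λ ()
... | false | false = λ ()

-- Quarters on opposite sides differ by 1 or 3 modulo 4, so exactly one of the two is the successor
-- of the other.
next-one-way : ∀ {n} (x y : Fin n ⊎ Fin n) → T (left x xor left y) →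
               does (next (quarter y) Fin.≟ quarter x) ≡ not (does (next (quarter x) Fin.≟ quarter y))
next-one-way (inj₁ i) (inj₂ j) _ with half i | half j
... | true  | true  = refl
... | true  | false = refl
... | false | true  = refl
... | false | false = refl
next-one-way (inj₂ i) (inj₁ j) _ with half i | half j
... | true  | true  = refl
... | true  | false = refl
... | false | true  = refl
... | false | false = refl

cyclic : ∀ n → 𝒟 n
cyclic n = record
  { digraph       = λ u v → does (next (quarter (splitAt n u)) Fin.≟ quarter (splitAt n v))
  ; isOrientation = record
    { arcs-along-edges = λ u v → next-crosses (splitAt n u) (splitAt n v)
    ; one-direction    = λ u v → next-one-way (splitAt n u) (splitAt n v)
    }
  }

-- The parameter φ lets one count serve the row classes, with `next`, and the column classes, with
-- `id`.
count-quarter : ∀ h (φ : Fin 4 → Fin 4) y → let [_] = λ z → χ (does (y Fin.≟ φ z)) in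
  count (λ v → φ (quarter (splitAt (h * 2) v))) y ≡ h * ([ 0F ] + [ 2F ] + ([ 1F ] + [ 3F ]))
count-quarter h φ y = begin-equality
  ∑ (λ v → at (splitAt n v))
    ≡⟨ ∑-↑ n (λ v → at (splitAt n v)) ⟩
  ∑ (λ i → at (splitAt n (i ↑ˡ n))) + ∑ (λ j → at (splitAt n (n ↑ʳ j)))
    ≡⟨ cong₂ _+_ (∑-cong {n} λ i → cong at (Fin.splitAt-↑ˡ n i n)) (∑-cong {n} λ j → cong at (Fin.splitAt-↑ʳ n n j)) ⟩
  ∑ {n} (λ i → on-left (half i)) + ∑ {n} (λ j → on-right (half j))
    ≡⟨ cong₂ _+_ (∑-half h on-left) (∑-half h on-right) ⟩
  h * ([ 0F ] + [ 2F ]) + h * ([ 1F ] + [ 3F ])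
    ≡⟨ *-distribˡ-+ h ([ 0F ] + [ 2F ]) ([ 1F ] + [ 3F ]) ⟨
  h * ([ 0F ] + [ 2F ] + ([ 1F ] + [ 3F ])) ∎
  where
  n = h * 2
  [_] : Fin 4 → ℕ
  [ z ] = χ (does (y Fin.≟ φ z))
  at : Fin n ⊎ Fin n → ℕ
  at x = χ (does (y Fin.≟ φ (quarter x)))
  on-left on-right : Bool → ℕ
  on-left  b = [ if b then 0F else 2F ]
  on-right b = [ if b then 1F else 3F ]

per-cyclic : ∀ h → per A[ cyclic (h * 2) ] ≡ (h !) ^ 4
per-cyclic h = trans
  (per-classes (next ∘ quarter ∘ splitAt n) (quarter ∘ splitAt n) (λ y → trans (rows y) (sym (columns y))))
  (∏-cong {4} (λ y → cong _! (rows y)))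
  where
  n = h * 2
  rows : ∀ y → count (next ∘ quarter ∘ splitAt n) y ≡ h
  rows y = trans (count-quarter h next y) (trans (cong (h *_) (once y)) (*-identityʳ h))
    where
    once : ∀ y → let [_] = λ z → χ (does (y Fin.≟ next z)) in [ 0F ] + [ 2F ] + ([ 1F ] + [ 3F ]) ≡ 1
    once = λ { 0F → refl ; 1F → refl ; 2F → refl ; 3F → refl }
  columns : ∀ y → count (quarter ∘ splitAt n) y ≡ h
  columns y = trans (count-quarter h id y) (trans (cong (h *_) (once y)) (*-identityʳ h))
    where
    once : ∀ y → let [_] = λ z → χ (does (y Fin.≟ z)) in [ 0F ] + [ 2F ] + ([ 1F ] + [ 3F ]) ≡ 1
    once = λ { 0F → refl ; 1F → refl ; 2F → refl ; 3F → refl }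

-- When N divides M, α is 0 and the second factor of ω is a root of 1, whatever the order c of that
-- root. What remains is (k!)^(N/k), and the hypothesis says that p is at least this number.
ω≤ : ∀ {N M p k} (0<N : 0 < N) (N≤M : N ≤ M) → M ≡ k * N → (k !) ^ N ≤ p ^ k → ω[2× N , M ] 0<N N≤M ≤ℝ fromℕ p
ω≤ {N} {M} {p} {k} 0<N N≤M M≡kN k!^N≤p^k = *ℝ-≤ {p = p} proj₁ proj₁ λ {s} {t} 0≤s 0≤t s∈L t∈L →
  product-below-≤ k′ c {c * k′} {c} {k′} {(k′ !) ^ (N ∸ α)} {(c !) ^ α} {p} 0<ck refl (*-comm k′ c) bound 0≤s 0≤t
    (L-root⇒≤ {k′} {(k′ !) ^ (N ∸ α)} {s} 0≤s s∈L) (L-root⇒≤ {c} {(c !) ^ α} {t} 0≤t t∈L)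
  where
  instance
    N≢0 : NonZero N
    N≢0 = >-nonZero 0<N
  k′ = ⌊ M / N ⌋
  c = ⌈ M / N ⌉
  α = M ∸ N * k′
  instance
    k≢0 : NonZero k′
    k≢0 = >-nonZero (m≥n⇒m/n>0 N≤M)
    c≢0 : NonZero c
    c≢0 = >-nonZero (m≥n⇒m/n>0 (≤-trans N≤M (m≤m+n M (N ∸ 1))))
  0<ck : 0 < c * k′
  0<ck = >-nonZero⁻¹ (c * k′) {{m*n≢0 c k′}}
  k′≡k : k′ ≡ k
  k′≡k = trans (cong (_/ N) M≡kN) (m*n/n≡m k N)
  α≡0 : α ≡ 0
  α≡0 = m≤n⇒m∸n≡0 (≤-reflexive (trans M≡kN (trans (*-comm k N) (cong (N *_) (sym k′≡k)))))
  bound : ((k′ !) ^ (N ∸ α)) ^ c * ((c !) ^ α) ^ k′ ≤ p ^ (c * k′)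
  bound = begin
    ((k′ !) ^ (N ∸ α)) ^ c * ((c !) ^ α) ^ k′
      ≡⟨ cong₂ (λ α k → ((k !) ^ (N ∸ α)) ^ c * ((c !) ^ α) ^ k′) α≡0 k′≡k ⟩
    ((k !) ^ N) ^ c * 1 ^ k′                       ≡⟨ cong (((k !) ^ N) ^ c *_) (^-zeroˡ k′) ⟩
    ((k !) ^ N) ^ c * 1                            ≡⟨ *-identityʳ (((k !) ^ N) ^ c) ⟩
    ((k !) ^ N) ^ c                                ≤⟨ ^-monoˡ-≤ c k!^N≤p^k ⟩
    (p ^ k) ^ c                                    ≡⟨ ^-*-assoc p k c ⟩
    p ^ (k * c)                                    ≡⟨ cong (p ^_) (trans (*-comm k c) (cong (c *_) (sym k′≡k))) ⟩
    p ^ (c * k′)                                   ∎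

mainTheorem2 : ∀ (n : ℕ) (2≤n : 2 ≤ n) →
    (∀ (D : 𝒟 n) → fromℕ (per A[ D ]) ≤ℝ ω[2× 2 * n , n ^ 2 ] (0<2n 2≤n) (2n≤n² 2≤n))
    × (2 ∣ n → Σ[ D ∈ 𝒟 n ] fromℕ (per A[ D ]) ≈ℝ ω[2× 2 * n , n ^ 2 ] (0<2n 2≤n) (2n≤n² 2≤n))
mainTheorem2 n 2≤n = upper , sharp
  where
  upper : ∀ (D : 𝒟 n) → fromℕ (per A[ D ]) ≤ℝ ω[2× 2 * n , n ^ 2 ] (0<2n 2≤n) (2n≤n² 2≤n)
  upper D = per≤ω {N = 2 * n} {M = n ^ 2} (𝒟.digraph D) (cong (n +_) (sym (+-identityʳ n)))
    (number-of-arcs D) (0<2n 2≤n) (2n≤n² 2≤n)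

  lower : ∀ {n} h → n ≡ h * 2 → (D : 𝒟 n) → per A[ D ] ≡ (h !) ^ 4 → (0<N : 0 < 2 * n) (N≤M : 2 * n ≤ n ^ 2) →
          ω[2× 2 * n , n ^ 2 ] 0<N N≤M ≤ℝ fromℕ (per A[ D ])
  -- From n = 2h follow n^2 = h * (2 * n), so the common degree is h, and (h!)^(2 * n) = ((h!)^4)^h,
  -- the h-th power of the permanent.
  lower {n} h n≡2h D per≡ 0<N N≤M = ω≤ {N = 2 * n} {M = n ^ 2} {p = per A[ D ]} {k = h} 0<N N≤M
    (trans (cong (λ z → z * (n * 1)) n≡2h) (solve 2 (λ h n → h :* con 2 :* (n :* con 1) := h :* (con 2 :* n)) refl h n))
    (≤-reflexive (sym (trans (cong (_^ h) per≡) (trans (^-*-assoc (h !) 4 h) (cong ((h !) ^_)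
      (trans (solve 1 (λ h → con 4 :* h := con 2 :* (h :* con 2)) refl h) (cong (2 *_) (sym n≡2h))))))))

  sharp : 2 ∣ n → Σ[ D ∈ 𝒟 n ] fromℕ (per A[ D ]) ≈ℝ ω[2× 2 * n , n ^ 2 ] (0<2n 2≤n) (2n≤n² 2≤n)
  sharp (divides h n≡2h) = cyclic n , upper (cyclic n) , lower h n≡2h (cyclic n)
    (trans (cong (λ n → per A[ cyclic n ]) n≡2h) (per-cyclic h)) (0<2n 2≤n) (2n≤n² 2≤n)
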